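{- Let $\zeta=e^{\pi i/4}$ and let $$A=\begin{pmatrix}0&0&0&0&0&0\\0&4&2&6&6&2\\0&2&4&3&7&6\\0&6&1&4&2&5\\0&6&5&2&4&1\\0&2&6&7&3&4\end{pmatrix}$$ with entries in $\mathbb{Z}/8\mathbb{Z}$ and rows and columns indexed by $0,\dots,5$. Let $H$ be the $6\times 6$ complex matrix with entries $H_{rs}=\zeta^{A_{rs}}$, let $h_0,\dots,h_5\in\mathbb{C}^6$ be its columns, and let $\Phi_{19}$ be the $6\times 6$ array of vectors with $(i,j)$ entry $\frac{1}{\sqrt6}(h_i\odot h_j)\in\mathbb{C}^6$, $0\le i,j\le 5$. Then $\Phi_{19}$ is a quantum Latin square of order $6$ and its cardinality is $19$.
   Context: For $x,y\in\mathbb{C}^n$, $x\odot y=(x_0y_0,\dots,x_{n-1}y_{n-1})^{\mathsf T}$ is the entrywise (Schur) product. A quantum Latin square of order $n$, denoted $\mathrm{QLS}(n)$, is an $n\times n$ array $(\phi_{ij})_{0\le i,j\le n-1}$ of unit vectors in $\mathbb{C}^n$ such that every row and every column forms an orthonormal basis of $\mathbb{C}^n$. Two unit vectors $u,v$ are phase equivalent, $u\sim v$, if $u=e^{i\alpha}v$ for some $\alpha\in\mathbb{R}$. The cardinality of a quantum Latin square is the number of distinct phase-equivalence classes among its $n^2$ entries. -}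

module Defs where

open import Algebra.Bundles.Raw using (RawRing)
import Algebra.Definitions.RawSemiring as RawSemiringDefinitions
open import Data.Fin using (Fin; toℕ; #_)
open import Data.Integer.Base as ℤ using (+_; -[1+_])
import Data.Integer.Properties as ℤ
open import Data.Nat.Base as ℕ using (ℕ; zero; suc; _!)
open import Data.Nat.Properties as ℕ using (_!≢0)
open import Data.Product.Base using (∃; _×_; _,_; proj₁; proj₂)
open import Data.Rational.Base as ℚ using (ℚ; 0ℚ; 1ℚ; ½; _/_; fromℚᵘ; toℚᵘ)
import Data.Rational.Properties as ℚ
open import Data.Rational.Solver using (module +-*-Solver)
open import Data.Rational.Unnormalised.Base as ℚᵘ using (ℚᵘ; mkℚᵘ)
import Data.Rational.Unnormalised.Properties as ℚᵘ
open import Data.Sum.Base using (_⊎_; inj₁; inj₂)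
open import Data.Vec.Base as Vec using (Vec; []; _∷_)
open import Data.Vec.Functional using (Vector)
open import Function.Definitions using (Bijective)
open import Level using (0ℓ)
open import Relation.Binary.PropositionalEquality
open import Relation.Nullary using (¬_; yes; no)

module ℚ-Lemmas where
  open import Data.Rational.Base
  open +-*-Solver
  open ℚ.≤-Reasoning

  ½-positive : ∀ {ε} → 0ℚ < ε → 0ℚ < ½ * ε
  ½-positive {ε} p = ℚ.positive⁻¹ (½ * ε) {{ℚ.pos*pos⇒pos ½ ε {{positive p}}}}

  ½+½ : ∀ ε → ½ * ε + ½ * ε ≡ ε
  ½+½ = solve 1 (λ e → con ½ :* e :+ con ½ :* e := e) refl

  1+-positive : ∀ {q} → 0ℚ ≤ q → 0ℚ < 1ℚ + q
  1+-positive {q} p = ℚ.positive⁻¹ (1ℚ + q) {{ℚ.pos+nonNeg⇒pos 1ℚ q {{nonNegative p}}}}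

  0≤+ : ∀ {p q} → 0ℚ ≤ p → 0ℚ ≤ q → 0ℚ ≤ p + q
  0≤+ = ℚ.+-mono-≤

  0≤* : ∀ {p q} → 0ℚ ≤ p → 0ℚ ≤ q → 0ℚ ≤ p * q
  0≤* {p} {q} a b = ℚ.nonNegative⁻¹ (p * q)
    {{ℚ.nonNeg*nonNeg⇒nonNeg p {{nonNegative a}} q {{nonNegative b}}}}

  *-mono-≤ : ∀ {p q r s} → 0ℚ ≤ p → 0ℚ ≤ s → p ≤ q → r ≤ s → p * r ≤ q * s
  *-mono-≤ {p} {q} {r} {s} 0≤p 0≤s p≤q r≤s = ℚ.≤-trans
    (ℚ.*-monoˡ-≤-nonNeg p {{nonNegative 0≤p}} r≤s)
    (ℚ.*-monoʳ-≤-nonNeg s {{nonNegative 0≤s}} p≤q)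

  quotient : ∀ {M ε} → 0ℚ < M → 0ℚ < ε → ∃ λ δ → 0ℚ < δ × M * δ ≡ ε
  quotient {M} {ε} 0<M 0<ε = M⁻¹ * ε
    , ℚ.positive⁻¹ (M⁻¹ * ε)
        {{ℚ.pos*pos⇒pos M⁻¹ {{ℚ.1/pos⇒pos M {{positive 0<M}}}} ε {{positive 0<ε}}}}
    , trans (sym (ℚ.*-assoc M M⁻¹ ε))
        (trans (cong (_* ε) (ℚ.*-inverseʳ M {{>-nonZero 0<M}})) (ℚ.*-identityˡ ε))
    where M⁻¹ = (1/ M) {{>-nonZero 0<M}}

  p≤∣p∣ : ∀ p → p ≤ ∣ p ∣
  p≤∣p∣ p with ℚ.≤-total 0ℚ p
  ... | inj₁ 0≤p = ℚ.≤-reflexive (sym (ℚ.0≤p⇒∣p∣≡p 0≤p))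
  ... | inj₂ p≤0 = ℚ.≤-trans p≤0 (ℚ.0≤∣p∣ p)

  ∣∣≤ : ∀ {p e} → p ≤ e → - p ≤ e → ∣ p ∣ ≤ e
  ∣∣≤ {p} a b with ℚ.∣p∣≡p∨∣p∣≡-p p
  ... | inj₁ eq = ℚ.≤-trans (ℚ.≤-reflexive eq) a
  ... | inj₂ eq = ℚ.≤-trans (ℚ.≤-reflexive eq) b

  ∣-∣-comm : ∀ p q → ∣ p - q ∣ ≡ ∣ q - p ∣
  ∣-∣-comm p q = trans (sym (ℚ.∣-p∣≡∣p∣ (p - q)))
    (cong ∣_∣ (solve 2 (λ p q → :- (p :- q) := q :- p) refl p q))

  ∣∣-via-difference : ∀ p q → ∣ p ∣ ≤ ∣ p - q ∣ + ∣ q ∣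
  ∣∣-via-difference p q = begin
    ∣ p ∣               ≡⟨ cong ∣_∣ (solve 2 (λ p q → p := (p :- q) :+ q) refl p q) ⟩
    ∣ (p - q) + q ∣     ≤⟨ ℚ.∣p+q∣≤∣p∣+∣q∣ (p - q) q ⟩
    ∣ p - q ∣ + ∣ q ∣   ∎

  ∣+-+∣ : ∀ a b c d → ∣ (a + b) - (c + d) ∣ ≤ ∣ a - c ∣ + ∣ b - d ∣
  ∣+-+∣ a b c d = begin
    ∣ (a + b) - (c + d) ∣    ≡⟨ cong ∣_∣ (solve 4 (λ a b c d →
                                  (a :+ b) :- (c :+ d) := (a :- c) :+ (b :- d)) refl a b c d) ⟩
    ∣ (a - c) + (b - d) ∣    ≤⟨ ℚ.∣p+q∣≤∣p∣+∣q∣ (a - c) (b - d) ⟩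
    ∣ a - c ∣ + ∣ b - d ∣    ∎

  ∣*-*∣ : ∀ a b c d → ∣ a * b - c * d ∣ ≤ ∣ a ∣ * ∣ b - d ∣ + ∣ d ∣ * ∣ a - c ∣
  ∣*-*∣ a b c d = begin
    ∣ a * b - c * d ∣                          ≡⟨ cong ∣_∣ (solve 4 (λ a b c d →
                                                    a :* b :- c :* d := a :* (b :- d) :+ d :* (a :- c))
                                                    refl a b c d) ⟩
    ∣ a * (b - d) + d * (a - c) ∣              ≤⟨ ℚ.∣p+q∣≤∣p∣+∣q∣ (a * (b - d)) (d * (a - c)) ⟩
    ∣ a * (b - d) ∣ + ∣ d * (a - c) ∣          ≡⟨ cong₂ _+_ (ℚ.∣p*q∣≡∣p∣*∣q∣ a (b - d))
                                                            (ℚ.∣p*q∣≡∣p∣*∣q∣ d (a - c)) ⟩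
    ∣ a ∣ * ∣ b - d ∣ + ∣ d ∣ * ∣ a - c ∣      ∎

  fromℚᵘ-homo-* : ∀ p q → fromℚᵘ (p ℚᵘ.* q) ≡ fromℚᵘ p * fromℚᵘ q
  fromℚᵘ-homo-* p q = ℚ.toℚᵘ-injective (ℚᵘ.≃-trans (ℚ.toℚᵘ-fromℚᵘ (p ℚᵘ.* q))
    (ℚᵘ.≃-trans (ℚᵘ.*-cong (ℚᵘ.≃-sym (ℚ.toℚᵘ-fromℚᵘ p)) (ℚᵘ.≃-sym (ℚ.toℚᵘ-fromℚᵘ q)))
      (ℚᵘ.≃-sym (ℚ.toℚᵘ-homo-* (fromℚᵘ p) (fromℚᵘ q)))))

  fromℚᵘ-homo-+ : ∀ p q → fromℚᵘ (p ℚᵘ.+ q) ≡ fromℚᵘ p + fromℚᵘ q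
  fromℚᵘ-homo-+ p q = ℚ.toℚᵘ-injective (ℚᵘ.≃-trans (ℚ.toℚᵘ-fromℚᵘ (p ℚᵘ.+ q))
    (ℚᵘ.≃-trans (ℚᵘ.+-cong (ℚᵘ.≃-sym (ℚ.toℚᵘ-fromℚᵘ p)) (ℚᵘ.≃-sym (ℚ.toℚᵘ-fromℚᵘ q)))
      (ℚᵘ.≃-sym (ℚ.toℚᵘ-homo-+ (fromℚᵘ p) (fromℚᵘ q)))))

  fromℚᵘ-mono-≤ : ∀ {p q} → p ℚᵘ.≤ q → fromℚᵘ p ≤ fromℚᵘ q
  fromℚᵘ-mono-≤ {p} {q} p≤q = ℚ.toℚᵘ-cancel-≤
    (ℚᵘ.≤-trans (ℚᵘ.≤-reflexive (ℚ.toℚᵘ-fromℚᵘ p))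
      (ℚᵘ.≤-trans p≤q (ℚᵘ.≤-reflexive (ℚᵘ.≃-sym (ℚ.toℚᵘ-fromℚᵘ q)))))

  ι : ℕ → ℚ
  ι n = + n / 1

  ι-suc : ∀ n → ι (suc n) ≡ 1ℚ + ι n
  ι-suc n = trans
    (ℚ.fromℚᵘ-cong {mkℚᵘ (+ suc n) 0} {mkℚᵘ (+ 1) 0 ℚᵘ.+ mkℚᵘ (+ n) 0}
      (ℚᵘ.*≡* (cong (ℤ._* + 1) (sym (cong (λ i → + 1 ℤ.+ i) (ℤ.*-identityʳ (+ n)))))))
    (fromℚᵘ-homo-+ (mkℚᵘ (+ 1) 0) (mkℚᵘ (+ n) 0))

  ι-mono-≤ : ∀ {m n} → m ℕ.≤ n → ι m ≤ ι n
  ι-mono-≤ {m} {n} m≤n = fromℚᵘ-mono-≤ {mkℚᵘ (+ m) 0} {mkℚᵘ (+ n) 0}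
    (ℚᵘ.*≤* (ℤ.*-monoʳ-≤-nonNeg (+ 1) (ℤ.+≤+ m≤n)))

  archimedean : ∀ q → ∃ λ n → q ≤ ι n
  archimedean q@(mkℚ (+ n) d _) = n , ℚ.≤-trans
    (ℚ.≤-reflexive (sym (ℚ.fromℚᵘ-toℚᵘ q)))
    (fromℚᵘ-mono-≤ {mkℚᵘ (+ n) d} {mkℚᵘ (+ n) 0}
      (ℚᵘ.*≤* (ℤ.*-monoˡ-≤-nonNeg (+ n) (ℤ.+≤+ (ℕ.s≤s ℕ.z≤n)))))
  archimedean q@(mkℚ -[1+ n ] _ _) = 0 , ℚ.<⇒≤ (ℚ.negative⁻¹ q)

  recip : ℕ → ℚ
  recip n = + 1 / suc n

  recip-positive : ∀ n → 0ℚ < recip n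
  recip-positive n = ℚ.positive⁻¹ (recip n) {{ℚ.normalize-pos 1 (suc n)}}

  recip-ι : ∀ n → recip n * ι (suc n) ≡ 1ℚ
  recip-ι n = trans (sym (fromℚᵘ-homo-* (mkℚᵘ (+ 1) n) (mkℚᵘ (+ suc n) 0)))
    (ℚ.fromℚᵘ-cong {mkℚᵘ (+ 1) n ℚᵘ.* mkℚᵘ (+ suc n) 0} {mkℚᵘ (+ 1) 0}
      (ℚᵘ.*≡* (cong (λ k → + suc k) lemma)))
    where
    lemma : (n ℕ.+ 0) ℕ.* 1 ≡ n ℕ.* 1 ℕ.+ 0
    lemma = trans (ℕ.*-identityʳ (n ℕ.+ 0)) (trans (ℕ.+-identityʳ n)
      (sym (trans (ℕ.+-identityʳ (n ℕ.* 1)) (ℕ.*-identityʳ n))))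

  1/-* : ∀ m n .{{_ : ℕ.NonZero n}} .{{_ : ℕ.NonZero (suc m ℕ.* n)}} →
         + 1 / (suc m ℕ.* n) ≡ recip m * (+ 1 / n)
  1/-* m (suc n) = fromℚᵘ-homo-* (mkℚᵘ (+ 1) m) (mkℚᵘ (+ 1) n)

  recip-<ε : ∀ {C ε} → 0ℚ < ε → ∃ λ N → ∀ n → N ℕ.≤ n → recip n * C < ε
  recip-<ε {C} {ε} 0<ε with quotient {ε} {1ℚ} 0<ε (ℚ.positive⁻¹ 1ℚ)
  ... | δ , 0<δ , εδ≡1 with archimedean (δ * C)
  ... | N , δC≤N = N , λ n N≤n → begin-strict
    recip n * C                ≡⟨ cong (recip n *_) (trans (sym (ℚ.*-identityˡ C))
                                    (trans (cong (_* C) (sym εδ≡1)) (ℚ.*-assoc ε δ C))) ⟩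
    recip n * (ε * (δ * C))    <⟨ ℚ.*-monoʳ-<-pos (recip n) {{positive (recip-positive n)}}
                                    (ℚ.*-monoʳ-<-pos ε {{positive 0<ε}} (δC< n N≤n)) ⟩
    recip n * (ε * ι (suc n))  ≡⟨ solve 3 (λ r e i → r :* (e :* i) := (r :* i) :* e) refl
                                    (recip n) ε (ι (suc n)) ⟩
    (recip n * ι (suc n)) * ε  ≡⟨ cong (_* ε) (recip-ι n) ⟩
    1ℚ * ε                     ≡⟨ ℚ.*-identityˡ ε ⟩
    ε                          ∎
    where
    δC< : ∀ n → N ℕ.≤ n → δ * C < ι (suc n)
    δC< n N≤n = begin-strict
      δ * C      ≤⟨ δC≤N ⟩
      ι N        ≤⟨ ι-mono-≤ N≤n ⟩
      ι n        ≡⟨ sym (ℚ.+-identityˡ (ι n)) ⟩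
      0ℚ + ι n   <⟨ ℚ.+-monoˡ-< (ι n) (ℚ.positive⁻¹ 1ℚ) ⟩
      1ℚ + ι n   ≡⟨ sym (ι-suc n) ⟩
      ι (suc n)  ∎

open ℚ-Lemmas

IsCauchy : (ℕ → ℚ) → Set
IsCauchy s = ∀ ε → 0ℚ ℚ.< ε →
  ∃ λ N → ∀ m n → N ℕ.≤ m → N ℕ.≤ n → ℚ.∣ s m ℚ.- s n ∣ ℚ.< ε

record ℝ : Set where
  constructor mkℝ
  field
    seq    : ℕ → ℚ
    cauchy : IsCauchy seq

open ℝ public

infix 4 _≈ʳ_ _<ʳ_

_≈ʳ_ : ℝ → ℝ → Set
x ≈ʳ y = ∀ ε → 0ℚ ℚ.< ε →
  ∃ λ N → ∀ n → N ℕ.≤ n → ℚ.∣ seq x n ℚ.- seq y n ∣ ℚ.< ε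

_<ʳ_ : ℝ → ℝ → Set
x <ʳ y = ∃ λ ε → 0ℚ ℚ.< ε ×
  ∃ λ N → ∀ n → N ℕ.≤ n → seq x n ℚ.+ ε ℚ.≤ seq y n

module Cauchy-Lemmas where
  open import Data.Rational.Base
  open +-*-Solver
  open ℚ.≤-Reasoning

  constant-cauchy : ∀ q → IsCauchy (λ _ → q)
  constant-cauchy q ε 0<ε = 0 , λ _ _ _ _ →
    subst (λ p → ∣ p ∣ < ε) (sym (ℚ.+-inverseʳ q)) 0<ε

  EventuallyBoundedBy : (ℕ → ℚ) → ℕ → ℚ → Set
  EventuallyBoundedBy s N M = ∀ n → N ℕ.≤ n → ∣ s n ∣ ≤ M

  cauchy-bounded : ∀ {s} → IsCauchy s → ∃ λ N → ∃ λ M → 0ℚ < M × EventuallyBoundedBy s N M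
  cauchy-bounded {s} c with c 1ℚ (ℚ.positive⁻¹ 1ℚ)
  ... | N , bound = N , 1ℚ + ∣ s N ∣ , 1+-positive (ℚ.0≤∣p∣ (s N)) , λ n N≤n →
    ℚ.≤-trans (∣∣-via-difference (s n) (s N))
      (ℚ.+-monoˡ-≤ ∣ s N ∣ (ℚ.<⇒≤ (bound n N N≤n ℕ.≤-refl)))

  +-cauchy : ∀ {s t} → IsCauchy s → IsCauchy t → IsCauchy (λ n → s n + t n)
  +-cauchy {s} {t} c d ε 0<ε with c (½ * ε) (½-positive 0<ε) | d (½ * ε) (½-positive 0<ε)
  ... | N , p | N′ , q = N ℕ.+ N′ , λ m n N≤m N≤n → begin-strict
    ∣ (s m + t m) - (s n + t n) ∣    ≤⟨ ∣+-+∣ (s m) (t m) (s n) (t n) ⟩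
    ∣ s m - s n ∣ + ∣ t m - t n ∣    <⟨ ℚ.+-mono-<
        (p m n (ℕ.m+n≤o⇒m≤o N N≤m) (ℕ.m+n≤o⇒m≤o N N≤n))
        (q m n (ℕ.m+n≤o⇒n≤o N N≤m) (ℕ.m+n≤o⇒n≤o N N≤n)) ⟩
    ½ * ε + ½ * ε                    ≡⟨ ½+½ ε ⟩
    ε                                ∎

  neg-cauchy : ∀ {s} → IsCauchy s → IsCauchy (λ n → - s n)
  neg-cauchy {s} c ε 0<ε with c ε 0<ε
  ... | N , p = N , λ m n N≤m N≤n → subst (_< ε)
    (trans (sym (ℚ.∣-p∣≡∣p∣ (s m - s n))) (cong ∣_∣ (ℚ.neg-distrib-+ (s m) (- s n))))
    (p m n N≤m N≤n)

  *-cauchy : ∀ {s t} → IsCauchy s → IsCauchy t → IsCauchy (λ n → s n * t n)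
  *-cauchy {s} {t} c d ε 0<ε = L , λ m n L≤m L≤n → begin-strict
    ∣ s m * t m - s n * t n ∣                           ≤⟨ ∣*-*∣ (s m) (t m) (s n) (t n) ⟩
    ∣ s m ∣ * ∣ t m - t n ∣ + ∣ t n ∣ * ∣ s m - s n ∣   ≤⟨ ℚ.+-mono-≤
      (ℚ.*-monoʳ-≤-nonNeg ∣ t m - t n ∣ {{ℚ.∣-∣-nonNeg (t m - t n)}} (bs m (K≤ L≤m)))
      (ℚ.*-monoʳ-≤-nonNeg ∣ s m - s n ∣ {{ℚ.∣-∣-nonNeg (s m - s n)}} (bt n (K′≤ L≤n))) ⟩
    M * ∣ t m - t n ∣ + M′ * ∣ s m - s n ∣              <⟨ ℚ.+-mono-<
      (ℚ.*-monoʳ-<-pos M {{positive 0<M}} (q m n (N′≤ L≤m) (N′≤ L≤n)))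
      (ℚ.*-monoʳ-<-pos M′ {{positive 0<M′}} (p m n (N≤ L≤m) (N≤ L≤n))) ⟩
    M * δ + M′ * δ′                                     ≡⟨ cong₂ _+_ Mδ M′δ′ ⟩
    ½ * ε + ½ * ε                                       ≡⟨ ½+½ ε ⟩
    ε                                                   ∎
    where
    s-bounded = cauchy-bounded {s} c
    t-bounded = cauchy-bounded {t} d
    K    = proj₁ s-bounded
    M    = proj₁ (proj₂ s-bounded)
    0<M  = proj₁ (proj₂ (proj₂ s-bounded))
    bs   = proj₂ (proj₂ (proj₂ s-bounded))
    K′   = proj₁ t-bounded
    M′   = proj₁ (proj₂ t-bounded)
    0<M′ = proj₁ (proj₂ (proj₂ t-bounded))
    bt   = proj₂ (proj₂ (proj₂ t-bounded))
    δ-data  = quotient {M} {½ * ε} 0<M (½-positive 0<ε)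
    δ′-data = quotient {M′} {½ * ε} 0<M′ (½-positive 0<ε)
    δ    = proj₁ δ-data
    Mδ   = proj₂ (proj₂ δ-data)
    δ′   = proj₁ δ′-data
    M′δ′ = proj₂ (proj₂ δ′-data)
    N    = proj₁ (c δ′ (proj₁ (proj₂ δ′-data)))
    p    = proj₂ (c δ′ (proj₁ (proj₂ δ′-data)))
    N′   = proj₁ (d δ (proj₁ (proj₂ δ-data)))
    q    = proj₂ (d δ (proj₁ (proj₂ δ-data)))
    L = (K ℕ.+ K′) ℕ.+ (N ℕ.+ N′)
    K≤ : ∀ {n} → L ℕ.≤ n → K ℕ.≤ n
    K≤ h = ℕ.m+n≤o⇒m≤o K (ℕ.m+n≤o⇒m≤o (K ℕ.+ K′) h)
    K′≤ : ∀ {n} → L ℕ.≤ n → K′ ℕ.≤ n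
    K′≤ h = ℕ.m+n≤o⇒n≤o K (ℕ.m+n≤o⇒m≤o (K ℕ.+ K′) h)
    N≤ : ∀ {n} → L ℕ.≤ n → N ℕ.≤ n
    N≤ h = ℕ.m+n≤o⇒m≤o N (ℕ.m+n≤o⇒n≤o (K ℕ.+ K′) h)
    N′≤ : ∀ {n} → L ℕ.≤ n → N′ ℕ.≤ n
    N′≤ h = ℕ.m+n≤o⇒n≤o N (ℕ.m+n≤o⇒n≤o (K ℕ.+ K′) h)

  recip-cauchy : ∀ (t : ℕ → ℚ) → (∀ m k → t m ≤ t k + recip k) → IsCauchy t
  recip-cauchy t t≤ ε 0<ε = N , λ m k N≤m N≤k →
    ℚ.≤-<-trans (∣∣≤ (p≤⊔ m k) (-p≤⊔ m k)) (⊔< m k N≤m N≤k)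
    where
    N = proj₁ (recip-<ε {1ℚ} 0<ε)
    less : ∀ k → N ℕ.≤ k → recip k < ε
    less k N≤k = subst (_< ε) (ℚ.*-identityʳ (recip k)) (proj₂ (recip-<ε {1ℚ} 0<ε) k N≤k)
    difference : ∀ m k → t m - t k ≤ recip k
    difference m k = begin
      t m - t k               ≤⟨ ℚ.+-monoˡ-≤ (- t k) (t≤ m k) ⟩
      (t k + recip k) - t k   ≡⟨ solve 2 (λ x r → (x :+ r) :- x := r) refl (t k) (recip k) ⟩
      recip k                 ∎
    p≤⊔ : ∀ m k → t m - t k ≤ recip m ⊔ recip k
    p≤⊔ m k = ℚ.≤-trans (difference m k) (ℚ.p≤q⊔p (recip m) (recip k))
    -p≤⊔ : ∀ m k → - (t m - t k) ≤ recip m ⊔ recip k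
    -p≤⊔ m k = begin
      - (t m - t k)       ≡⟨ solve 2 (λ x y → :- (x :- y) := y :- x) refl (t m) (t k) ⟩
      t k - t m           ≤⟨ difference k m ⟩
      recip m             ≤⟨ ℚ.p≤p⊔q (recip m) (recip k) ⟩
      recip m ⊔ recip k   ∎
    ⊔< : ∀ m k → N ℕ.≤ m → N ℕ.≤ k → recip m ⊔ recip k < ε
    ⊔< m k N≤m N≤k = case (ℚ.⊔-sel (recip m) (recip k))
      where
      case : recip m ⊔ recip k ≡ recip m ⊎ recip m ⊔ recip k ≡ recip k → recip m ⊔ recip k < ε
      case (inj₁ eq) = subst (_< ε) (sym eq) (less m N≤m)
      case (inj₂ eq) = subst (_< ε) (sym eq) (less k N≤k)

open Cauchy-Lemmas

-- The Cauchy proofs are abstract so that they are never normalised.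
abstract

  fromℚ-cauchy : ∀ q → IsCauchy (λ _ → q)
  fromℚ-cauchy = constant-cauchy

  +ʳ-cauchy : ∀ x y → IsCauchy (λ n → seq x n ℚ.+ seq y n)
  +ʳ-cauchy x y = +-cauchy {seq x} {seq y} (cauchy x) (cauchy y)

  *ʳ-cauchy : ∀ x y → IsCauchy (λ n → seq x n ℚ.* seq y n)
  *ʳ-cauchy x y = *-cauchy {seq x} {seq y} (cauchy x) (cauchy y)

  -ʳ-cauchy : ∀ x → IsCauchy (λ n → ℚ.- seq x n)
  -ʳ-cauchy x = neg-cauchy {seq x} (cauchy x)

fromℚ : ℚ → ℝ
fromℚ q = mkℝ (λ _ → q) (fromℚ-cauchy q)

infixl 6 _+ʳ_
infixl 7 _*ʳ_
infix  8 -ʳ_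

_+ʳ_ : ℝ → ℝ → ℝ
x +ʳ y = mkℝ (λ n → seq x n ℚ.+ seq y n) (+ʳ-cauchy x y)

_*ʳ_ : ℝ → ℝ → ℝ
x *ʳ y = mkℝ (λ n → seq x n ℚ.* seq y n) (*ʳ-cauchy x y)

-ʳ_ : ℝ → ℝ
-ʳ x = mkℝ (λ n → ℚ.- seq x n) (-ʳ-cauchy x)

0ℝ 1ℝ : ℝ
0ℝ = fromℚ 0ℚ
1ℝ = fromℚ 1ℚ

ℝ-rawRing : RawRing 0ℓ 0ℓ
ℝ-rawRing = record
  { Carrier = ℝ ; _≈_ = _≈ʳ_ ; _+_ = _+ʳ_ ; _*_ = _*ʳ_ ; -_ = -ʳ_ ; 0# = 0ℝ ; 1# = 1ℝ }

isqrt : ℕ → ℕ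
isqrt zero    = 0
isqrt (suc n) with suc (isqrt n) ℕ.* suc (isqrt n) ℕ.≤? suc n
... | yes _ = suc (isqrt n)
... | no  _ = isqrt n

module Sqrt-Lemmas where

  isqrt-lower : ∀ n → isqrt n ℕ.* isqrt n ℕ.≤ n
  isqrt-lower zero = ℕ.z≤n
  isqrt-lower (suc n) with suc (isqrt n) ℕ.* suc (isqrt n) ℕ.≤? suc n
  ... | yes p = p
  ... | no  _ = ℕ.m≤n⇒m≤1+n (isqrt-lower n)

  isqrt-upper : ∀ n → n ℕ.< suc (isqrt n) ℕ.* suc (isqrt n)
  isqrt-upper zero = ℕ.s≤s ℕ.z≤n
  isqrt-upper (suc n) with suc (isqrt n) ℕ.* suc (isqrt n) ℕ.≤? suc n
  ... | yes _ = ℕ.≤-<-trans (isqrt-upper n) (ℕ.*-mono-< (ℕ.n<1+n (suc (isqrt n))) (ℕ.n<1+n (suc (isqrt n))))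
  ... | no ¬p = ℕ.≰⇒> ¬p

  √-seq : ℕ → ℕ → ℚ
  √-seq n m = + isqrt (n ℕ.* (suc m ℕ.* suc m)) / suc m

  cross : ∀ n m k → isqrt (n ℕ.* (suc m ℕ.* suc m)) ℕ.* suc k
                    ℕ.< suc (isqrt (n ℕ.* (suc k ℕ.* suc k))) ℕ.* suc m
  cross n m k = ℕ.≰⇒> λ h → ℕ.<⇒≱ squares-< (ℕ.*-mono-≤ h h)
    where
    a = isqrt (n ℕ.* (suc m ℕ.* suc m))
    b = suc (isqrt (n ℕ.* (suc k ℕ.* suc k)))
    rearrange : ∀ x y → (x ℕ.* y) ℕ.* (x ℕ.* y) ≡ (x ℕ.* x) ℕ.* (y ℕ.* y)
    rearrange x y = ℕ.[m*n]*[o*p]≡[m*o]*[n*p] x y x y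
    swap : ∀ n x y → (n ℕ.* x) ℕ.* y ≡ (n ℕ.* y) ℕ.* x
    swap n x y = trans (ℕ.*-assoc n x y) (trans (cong (n ℕ.*_) (ℕ.*-comm x y)) (sym (ℕ.*-assoc n y x)))
    squares-< : (a ℕ.* suc k) ℕ.* (a ℕ.* suc k) ℕ.< (b ℕ.* suc m) ℕ.* (b ℕ.* suc m)
    squares-< = begin-strict
      (a ℕ.* suc k) ℕ.* (a ℕ.* suc k)                 ≡⟨ rearrange a (suc k) ⟩
      (a ℕ.* a) ℕ.* (suc k ℕ.* suc k)                 ≤⟨ ℕ.*-monoˡ-≤ (suc k ℕ.* suc k)
                                                           (isqrt-lower (n ℕ.* (suc m ℕ.* suc m))) ⟩
      (n ℕ.* (suc m ℕ.* suc m)) ℕ.* (suc k ℕ.* suc k) ≡⟨ swap n (suc m ℕ.* suc m) (suc k ℕ.* suc k) ⟩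
      (n ℕ.* (suc k ℕ.* suc k)) ℕ.* (suc m ℕ.* suc m) <⟨ ℕ.*-monoˡ-< (suc m ℕ.* suc m)
                                                           (isqrt-upper (n ℕ.* (suc k ℕ.* suc k))) ⟩
      (b ℕ.* b) ℕ.* (suc m ℕ.* suc m)                 ≡⟨ rearrange b (suc m) ⟨
      (b ℕ.* suc m) ℕ.* (b ℕ.* suc m)                 ∎
      where open ℕ.≤-Reasoning

  /-suc : ∀ a k → + suc a / suc k ≡ (+ a / suc k) ℚ.+ recip k
  /-suc a k = trans
    (ℚ.fromℚᵘ-cong {mkℚᵘ (+ suc a) k} {mkℚᵘ (+ a) k ℚᵘ.+ mkℚᵘ (+ 1) k}
      (ℚᵘ.*≡* (trans (cong (+ suc a ℤ.*_) (ℤ.pos-* (suc k) (suc k)))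
        (trans (sym (ℤ.*-assoc (+ suc a) (+ suc k) (+ suc k))) (cong (ℤ._* + suc k)
          (trans (cong (λ i → + i ℤ.* + suc k) (ℕ.+-comm 1 a))
            (ℤ.*-distribʳ-+ (+ suc k) (+ a) (+ 1))))))))
    (fromℚᵘ-homo-+ (mkℚᵘ (+ a) k) (mkℚᵘ (+ 1) k))

  √-seq-≤ : ∀ n m k → √-seq n m ℚ.≤ √-seq n k ℚ.+ recip k
  √-seq-≤ n m k = ℚ.≤-trans
    (fromℚᵘ-mono-≤ {mkℚᵘ (+ a) m} {mkℚᵘ (+ suc b) k} (ℚᵘ.*≤*
      (subst₂ ℤ._≤_ (ℤ.pos-* a (suc k)) (ℤ.pos-* (suc b) (suc m)) (ℤ.+≤+ (ℕ.<⇒≤ (cross n m k))))))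
    (ℚ.≤-reflexive (/-suc b k))
    where
    a = isqrt (n ℕ.* (suc m ℕ.* suc m))
    b = isqrt (n ℕ.* (suc k ℕ.* suc k))

  abstract

    √-cauchy : ∀ n → IsCauchy (√-seq n)
    √-cauchy n = recip-cauchy (√-seq n) (√-seq-≤ n)

-- ⌊ √n (m + 1) ⌋ / (m + 1) converges to √n.
√_ : ℕ → ℝ
√ n = mkℝ (λ m → + isqrt (n ℕ.* (suc m ℕ.* suc m)) / suc m) (Sqrt-Lemmas.√-cauchy n)

-- 1/√n = (1/n) √n.
1/√_ : (n : ℕ) .{{_ : ℕ.NonZero n}} → ℝ
1/√ n = fromℚ (+ 1 / n) *ʳ √ n

record Cartesian (A : Set) : Set where
  constructor _+i_
  field
    re : A
    im : A

open Cartesian public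

infix 5 _+i_

module Complexification (R : RawRing 0ℓ 0ℓ) where
  open RawRing R

  rawRing : RawRing 0ℓ 0ℓ
  rawRing = record
    { Carrier = Cartesian Carrier
    ; _≈_     = λ z w → re z ≈ re w × im z ≈ im w
    ; _+_     = λ z w → re z + re w +i im z + im w
    ; _*_     = λ z w → re z * re w + - (im z * im w) +i re z * im w + im z * re w
    ; -_      = λ z → - re z +i - im z
    ; 0#      = 0# +i 0#
    ; 1#      = 1# +i 0#
    }

  open RawSemiringDefinitions (RawRing.rawSemiring rawRing) using (_^_; sum) public

  real : Carrier → Cartesian Carrier
  real x = x +i 0#

  imaginary : Carrier → Cartesian Carrier
  imaginary y = 0# +i y

  conj : Cartesian Carrier → Cartesian Carrier
  conj z = re z +i - im z

ℂ : Set
ℂ = Cartesian ℝ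

ℚ[i] : Set
ℚ[i] = Cartesian ℚ

module ℂ    = Complexification ℝ-rawRing
module ℚ[i] = Complexification ℚ.+-*-rawRing

open RawRing ℂ.rawRing public using () renaming
  (_≈_ to _≈ᶜ_; _+_ to _+ᶜ_; _*_ to _*ᶜ_; -_ to -ᶜ_; 0# to 0ℂ; 1# to 1ℂ)

approx : ℂ → ℕ → ℚ[i]
approx z n = seq (re z) n +i seq (im z) n

expTerm : ℕ → ℚ[i] → ℚ[i]
expTerm k z = ℚ[i].real ((+ 1 / (k !)) {{k !≢0}}) * (z ^ k)
  where
  open RawRing ℚ[i].rawRing using (_*_)
  open ℚ[i] using (_^_)

expSum : ℕ → ℚ[i] → ℚ[i]
expSum zero    z = expTerm 0 z
expSum (suc n) z = expSum n z + expTerm (suc n) z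
  where open RawRing ℚ[i].rawRing using (_+_)

module Exp-Lemmas where
  open import Data.Rational.Base
  open +-*-Solver
  open ℚ.≤-Reasoning
  open RawRing ℚ[i].rawRing using () renaming (_+_ to _⊕_; _*_ to _⊗_; -_ to ⊖_)

  ‖_‖ : ℚ[i] → ℚ
  ‖ z ‖ = ∣ re z ∣ + ∣ im z ∣

  ‖‖-nonNeg : ∀ z → 0ℚ ≤ ‖ z ‖
  ‖‖-nonNeg z = 0≤+ (ℚ.0≤∣p∣ (re z)) (ℚ.0≤∣p∣ (im z))

  ‖⊕‖ : ∀ z w → ‖ z ⊕ w ‖ ≤ ‖ z ‖ + ‖ w ‖
  ‖⊕‖ (a +i b) (c +i d) = begin
    ∣ a + c ∣ + ∣ b + d ∣                      ≤⟨ ℚ.+-mono-≤ (ℚ.∣p+q∣≤∣p∣+∣q∣ a c) (ℚ.∣p+q∣≤∣p∣+∣q∣ b d) ⟩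
    (∣ a ∣ + ∣ c ∣) + (∣ b ∣ + ∣ d ∣)          ≡⟨ solve 4 (λ a b c d →
      (a :+ c) :+ (b :+ d) := (a :+ b) :+ (c :+ d)) refl (∣ a ∣) (∣ b ∣) (∣ c ∣) (∣ d ∣) ⟩
    (∣ a ∣ + ∣ b ∣) + (∣ c ∣ + ∣ d ∣)          ∎

  ‖⊗‖ : ∀ z w → ‖ z ⊗ w ‖ ≤ ‖ z ‖ * ‖ w ‖
  ‖⊗‖ (a +i b) (c +i d) = begin
    ∣ a * c + - (b * d) ∣ + ∣ a * d + b * c ∣
      ≤⟨ ℚ.+-mono-≤ (ℚ.∣p+q∣≤∣p∣+∣q∣ (a * c) (- (b * d))) (ℚ.∣p+q∣≤∣p∣+∣q∣ (a * d) (b * c)) ⟩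
    (∣ a * c ∣ + ∣ - (b * d) ∣) + (∣ a * d ∣ + ∣ b * c ∣)
      ≡⟨ cong₂ _+_ (cong₂ _+_ (ℚ.∣p*q∣≡∣p∣*∣q∣ a c)
                     (trans (ℚ.∣-p∣≡∣p∣ (b * d)) (ℚ.∣p*q∣≡∣p∣*∣q∣ b d)))
                   (cong₂ _+_ (ℚ.∣p*q∣≡∣p∣*∣q∣ a d) (ℚ.∣p*q∣≡∣p∣*∣q∣ b c)) ⟩
    (∣ a ∣ * ∣ c ∣ + ∣ b ∣ * ∣ d ∣) + (∣ a ∣ * ∣ d ∣ + ∣ b ∣ * ∣ c ∣)
      ≡⟨ solve 4 (λ a b c d → (a :* c :+ b :* d) :+ (a :* d :+ b :* c) := (a :+ b) :* (c :+ d))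
           refl (∣ a ∣) (∣ b ∣) (∣ c ∣) (∣ d ∣) ⟩
    (∣ a ∣ + ∣ b ∣) * (∣ c ∣ + ∣ d ∣) ∎

  infixl 7 _·_
  _·_ : ℚ → ℚ[i] → ℚ[i]
  r · z = r * re z +i r * im z

  ‖·‖ : ∀ {r} z → 0ℚ ≤ r → ‖ r · z ‖ ≡ r * ‖ z ‖
  ‖·‖ {r} (a +i b) 0≤r = trans
    (cong₂ _+_ (trans (ℚ.∣p*q∣≡∣p∣*∣q∣ r a) (cong (_* ∣ a ∣) (ℚ.0≤p⇒∣p∣≡p 0≤r)))
               (trans (ℚ.∣p*q∣≡∣p∣*∣q∣ r b) (cong (_* ∣ b ∣) (ℚ.0≤p⇒∣p∣≡p 0≤r))))
    (sym (ℚ.*-distribˡ-+ r (∣ a ∣) (∣ b ∣)))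

  expTerm-suc : ∀ k z → expTerm (suc k) z ≡ recip k · (expTerm k z ⊗ z)
  expTerm-suc k z@(a +i b) = trans
    (cong (λ q → ℚ[i].real q ⊗ (z ⊗ w)) (1/-* k (k !) {{k !≢0}} {{suc k !≢0}}))
    (cong₂ _+i_
      (solve 6 (λ r c a b p q →
        (r :* c) :* (a :* p :+ :- (b :* q)) :+ :- (con 0ℚ :* (a :* q :+ b :* p)) :=
        r :* ((c :* p :+ :- (con 0ℚ :* q)) :* a :+ :- ((c :* q :+ con 0ℚ :* p) :* b)))
        refl (recip k) c a b (re w) (im w))
      (solve 6 (λ r c a b p q →
        (r :* c) :* (a :* q :+ b :* p) :+ con 0ℚ :* (a :* p :+ :- (b :* q)) :=
        r :* ((c :* p :+ :- (con 0ℚ :* q)) :* b :+ (c :* q :+ con 0ℚ :* p) :* a))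
        refl (recip k) c a b (re w) (im w)))
    where
    w = ℚ[i]._^_ z k
    c = (+ 1 / (k !)) {{k !≢0}}

  recip-nonNeg : ∀ k → 0ℚ ≤ recip k
  recip-nonNeg k = ℚ.<⇒≤ (recip-positive k)

  module Majorant (B : ℚ) (0≤B : 0ℚ ≤ B) where

    s : ℕ → ℚ
    s zero    = 1ℚ
    s (suc k) = recip k * (s k * B)

    S : ℕ → ℚ
    S zero    = 0ℚ
    S (suc n) = S n + s n

    s-nonNeg : ∀ k → 0ℚ ≤ s k
    s-nonNeg zero    = ℚ.<⇒≤ (ℚ.positive⁻¹ 1ℚ)
    s-nonNeg (suc k) = 0≤* (recip-nonNeg k) (0≤* (s-nonNeg k) 0≤B)

    term-bound : ∀ k z → ‖ z ‖ ≤ B → ‖ expTerm k z ‖ ≤ s k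
    term-bound zero    z _ = ℚ.≤-refl
    term-bound (suc k) z h = begin
      ‖ expTerm (suc k) z ‖             ≡⟨ cong ‖_‖ (expTerm-suc k z) ⟩
      ‖ recip k · (expTerm k z ⊗ z) ‖   ≡⟨ ‖·‖ (expTerm k z ⊗ z) (recip-nonNeg k) ⟩
      recip k * ‖ expTerm k z ⊗ z ‖     ≤⟨ ℚ.*-monoˡ-≤-nonNeg (recip k) {{nonNegative (recip-nonNeg k)}}
        (ℚ.≤-trans (‖⊗‖ (expTerm k z) z)
          (*-mono-≤ (‖‖-nonNeg (expTerm k z)) 0≤B (term-bound k z h) h)) ⟩
      recip k * (s k * B)               ∎

    s-suc : ∀ k → s k * B ≡ ι (suc k) * s (suc k)
    s-suc k = sym (begin-equality
      ι (suc k) * (recip k * (s k * B))   ≡⟨ solve 3 (λ i r x → i :* (r :* x) := (r :* i) :* x) refl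
                                               (ι (suc k)) (recip k) (s k * B) ⟩
      (recip k * ι (suc k)) * (s k * B)   ≡⟨ cong (_* (s k * B)) (recip-ι k) ⟩
      1ℚ * (s k * B)                      ≡⟨ ℚ.*-identityˡ (s k * B) ⟩
      s k * B                             ∎)

    expTerm-difference : ∀ k z w → expTerm (suc k) z ⊕ (⊖ expTerm (suc k) w) ≡
      recip k · ((expTerm k z ⊗ (z ⊕ (⊖ w))) ⊕ ((expTerm k z ⊕ (⊖ expTerm k w)) ⊗ w))
    expTerm-difference k z w = trans
      (cong₂ (λ x y → x ⊕ (⊖ y)) (expTerm-suc k z) (expTerm-suc k w))
      (cong₂ _+i_
        (solve 9 (λ r t t′ u u′ a b c d →
          r :* (t :* a :+ :- (t′ :* b)) :+ :- (r :* (u :* c :+ :- (u′ :* d))) :=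
          r :* ((t :* (a :+ :- c) :+ :- (t′ :* (b :+ :- d))) :+
                ((t :+ :- u) :* c :+ :- ((t′ :+ :- u′) :* d))))
          refl (recip k) (re t) (im t) (re u) (im u) (re z) (im z) (re w) (im w))
        (solve 9 (λ r t t′ u u′ a b c d →
          r :* (t :* b :+ t′ :* a) :+ :- (r :* (u :* d :+ u′ :* c)) :=
          r :* ((t :* (b :+ :- d) :+ t′ :* (a :+ :- c)) :+
                ((t :+ :- u) :* d :+ (t′ :+ :- u′) :* c)))
          refl (recip k) (re t) (im t) (re u) (im u) (re z) (im z) (re w) (im w)))
      where
      t = expTerm k z
      u = expTerm k w

    term-lipschitz : ∀ k z w → ‖ z ‖ ≤ B → ‖ w ‖ ≤ B →
      ‖ expTerm k z ⊕ (⊖ expTerm k w) ‖ * B ≤ ι k * s k * ‖ z ⊕ (⊖ w) ‖ ×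
      ‖ expTerm (suc k) z ⊕ (⊖ expTerm (suc k) w) ‖ ≤ s k * ‖ z ⊕ (⊖ w) ‖
    term-lipschitz k z w hz hw = first k , second
      where
      δ = ‖ z ⊕ (⊖ w) ‖
      first : ∀ k → ‖ expTerm k z ⊕ (⊖ expTerm k w) ‖ * B ≤ ι k * s k * δ
      first zero    = ℚ.≤-reflexive
        (solve 2 (λ b d → con 0ℚ :* b := con 0ℚ :* con 1ℚ :* d) refl B δ)
      first (suc k) = begin
        ‖ expTerm (suc k) z ⊕ (⊖ expTerm (suc k) w) ‖ * B
          ≤⟨ ℚ.*-monoʳ-≤-nonNeg B {{nonNegative 0≤B}} (proj₂ (term-lipschitz k z w hz hw)) ⟩
        s k * δ * B                   ≡⟨ solve 3 (λ s d b → s :* d :* b := s :* b :* d) refl (s k) δ B ⟩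
        s k * B * δ                   ≡⟨ cong (_* δ) (s-suc k) ⟩
        ι (suc k) * s (suc k) * δ     ∎
      second : ‖ expTerm (suc k) z ⊕ (⊖ expTerm (suc k) w) ‖ ≤ s k * δ
      second = begin
        ‖ expTerm (suc k) z ⊕ (⊖ expTerm (suc k) w) ‖
          ≡⟨ cong ‖_‖ (expTerm-difference k z w) ⟩
        ‖ recip k · (p ⊕ q) ‖                  ≡⟨ ‖·‖ (p ⊕ q) (recip-nonNeg k) ⟩
        recip k * ‖ p ⊕ q ‖                    ≤⟨ ℚ.*-monoˡ-≤-nonNeg (recip k) {{nonNegative (recip-nonNeg k)}}
          (ℚ.≤-trans (‖⊕‖ p q) (ℚ.+-mono-≤ p-bound q-bound)) ⟩
        recip k * (s k * δ + ι k * s k * δ)    ≡⟨ solve 4 (λ r s d i →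
          r :* (s :* d :+ i :* s :* d) := (r :* (con 1ℚ :+ i)) :* (s :* d)) refl (recip k) (s k) δ (ι k) ⟩
        (recip k * (1ℚ + ι k)) * (s k * δ)     ≡⟨ cong (_* (s k * δ))
          (trans (cong (recip k *_) (sym (ι-suc k))) (recip-ι k)) ⟩
        1ℚ * (s k * δ)                         ≡⟨ ℚ.*-identityˡ (s k * δ) ⟩
        s k * δ                                ∎
        where
        d = expTerm k z ⊕ (⊖ expTerm k w)
        p = expTerm k z ⊗ (z ⊕ (⊖ w))
        q = d ⊗ w
        p-bound : ‖ p ‖ ≤ s k * δ
        p-bound = ℚ.≤-trans (‖⊗‖ (expTerm k z) (z ⊕ (⊖ w)))
          (ℚ.*-monoʳ-≤-nonNeg δ {{nonNegative (‖‖-nonNeg (z ⊕ (⊖ w)))}} (term-bound k z hz))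
        q-bound : ‖ q ‖ ≤ ι k * s k * δ
        q-bound = ℚ.≤-trans (‖⊗‖ d w) (ℚ.≤-trans
          (ℚ.*-monoˡ-≤-nonNeg ‖ d ‖ {{nonNegative (‖‖-nonNeg d)}} hw) (first k))

    sum-lipschitz : ∀ n z w → ‖ z ‖ ≤ B → ‖ w ‖ ≤ B →
      ‖ expSum n z ⊕ (⊖ expSum n w) ‖ ≤ S n * ‖ z ⊕ (⊖ w) ‖
    sum-lipschitz zero z w _ _ = ℚ.≤-reflexive (sym (ℚ.*-zeroˡ ‖ z ⊕ (⊖ w) ‖))
    sum-lipschitz (suc n) z w hz hw = begin
      ‖ (e ⊕ t) ⊕ (⊖ (e′ ⊕ t′)) ‖                ≡⟨ cong ‖_‖ (cong₂ _+i_
        (rearrange (re e) (re t) (re e′) (re t′)) (rearrange (im e) (im t) (im e′) (im t′))) ⟩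
      ‖ (e ⊕ (⊖ e′)) ⊕ (t ⊕ (⊖ t′)) ‖            ≤⟨ ‖⊕‖ (e ⊕ (⊖ e′)) (t ⊕ (⊖ t′)) ⟩
      ‖ e ⊕ (⊖ e′) ‖ + ‖ t ⊕ (⊖ t′) ‖            ≤⟨ ℚ.+-mono-≤ (sum-lipschitz n z w hz hw)
                                                      (proj₂ (term-lipschitz n z w hz hw)) ⟩
      S n * δ + s n * δ                          ≡⟨ sym (ℚ.*-distribʳ-+ δ (S n) (s n)) ⟩
      (S n + s n) * δ                            ∎
      where
      δ  = ‖ z ⊕ (⊖ w) ‖
      e  = expSum n z
      e′ = expSum n w
      t  = expTerm (suc n) z
      t′ = expTerm (suc n) w
      rearrange : ∀ a b c d → (a + b) + - (c + d) ≡ (a + - c) + (b + - d)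
      rearrange = solve 4 (λ a b c d → (a :+ b) :+ :- (c :+ d) := (a :+ :- c) :+ (b :+ :- d)) refl

    sum-tail : ∀ n j z → ‖ z ‖ ≤ B →
      ‖ expSum (j ℕ.+ n) z ⊕ (⊖ expSum n z) ‖ ≤ S (suc (j ℕ.+ n)) - S (suc n)
    sum-tail n zero z _ = ℚ.≤-reflexive (trans
      (cong₂ (λ p q → ∣ p ∣ + ∣ q ∣) (ℚ.+-inverseʳ (re (expSum n z))) (ℚ.+-inverseʳ (im (expSum n z))))
      (sym (ℚ.+-inverseʳ (S (suc n)))))
    sum-tail n (suc j) z h = begin
      ‖ (e ⊕ t) ⊕ (⊖ e′) ‖              ≡⟨ cong ‖_‖ (cong₂ _+i_
        (rearrange (re e) (re t) (re e′)) (rearrange (im e) (im t) (im e′))) ⟩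
      ‖ (e ⊕ (⊖ e′)) ⊕ t ‖              ≤⟨ ‖⊕‖ (e ⊕ (⊖ e′)) t ⟩
      ‖ e ⊕ (⊖ e′) ‖ + ‖ t ‖            ≤⟨ ℚ.+-mono-≤ (sum-tail n j z h) (term-bound (suc (j ℕ.+ n)) z h) ⟩
      (S m - S (suc n)) + s m           ≡⟨ rearrange (S m) (s m) (S (suc n)) ⟨
      (S m + s m) - S (suc n)           ∎
      where
      m  = suc (j ℕ.+ n)
      e  = expSum (j ℕ.+ n) z
      e′ = expSum n z
      t  = expTerm m z
      rearrange : ∀ a b c → (a + b) + - c ≡ (a + - c) + b
      rearrange = solve 3 (λ a b c → (a :+ b) :+ :- c := (a :+ :- c) :+ b) refl

    module Tail (K : ℕ) (2B≤K : B + B ≤ ι K) where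

      s-halves : ∀ n → K ℕ.≤ n → s (suc n) + s (suc n) ≤ s n
      s-halves n K≤n = begin
        r * (s n * B) + r * (s n * B)   ≡⟨ solve 3 (λ r s b →
          r :* (s :* b) :+ r :* (s :* b) := (r :* s) :* (b :+ b)) refl r (s n) B ⟩
        (r * s n) * (B + B)             ≤⟨ ℚ.*-monoˡ-≤-nonNeg (r * s n)
          {{nonNegative (0≤* (recip-nonNeg n) (s-nonNeg n))}}
          (ℚ.≤-trans 2B≤K (ι-mono-≤ (ℕ.m≤n⇒m≤1+n K≤n))) ⟩
        (r * s n) * ι (suc n)           ≡⟨ solve 3 (λ r s i → (r :* s) :* i := (r :* i) :* s) refl
                                             r (s n) (ι (suc n)) ⟩
        (r * ι (suc n)) * s n           ≡⟨ cong (_* s n) (recip-ι n) ⟩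
        1ℚ * s n                        ≡⟨ ℚ.*-identityˡ (s n) ⟩
        s n                             ∎
        where r = recip n

      s-antitone : ∀ j → s (j ℕ.+ K) ≤ s K
      s-antitone zero    = ℚ.≤-refl
      s-antitone (suc j) = begin
        s (suc (j ℕ.+ K))                       ≡⟨ sym (ℚ.+-identityʳ (s (suc (j ℕ.+ K)))) ⟩
        s (suc (j ℕ.+ K)) + 0ℚ                  ≤⟨ ℚ.+-monoʳ-≤ (s (suc (j ℕ.+ K))) (s-nonNeg (suc (j ℕ.+ K))) ⟩
        s (suc (j ℕ.+ K)) + s (suc (j ℕ.+ K))   ≤⟨ s-halves (j ℕ.+ K) (ℕ.m≤n+m K j) ⟩
        s (j ℕ.+ K)                             ≤⟨ s-antitone j ⟩
        s K                                     ∎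

      U : ℕ → ℚ
      U n = S n + (s n + s n)

      U-antitone : ∀ n j → K ℕ.≤ n → U (j ℕ.+ n) ≤ U n
      U-antitone n zero    _   = ℚ.≤-refl
      U-antitone n (suc j) K≤n = ℚ.≤-trans
        (begin
          (S m + s m) + (s (suc m) + s (suc m))   ≤⟨ ℚ.+-monoʳ-≤ (S m + s m)
                                                       (s-halves m (ℕ.≤-trans K≤n (ℕ.m≤n+m n j))) ⟩
          (S m + s m) + s m                       ≡⟨ ℚ.+-assoc (S m) (s m) (s m) ⟩
          S m + (s m + s m)                       ∎)
        (U-antitone n j K≤n)
        where m = j ℕ.+ n

      S≤U : ∀ n → S n ≤ U n
      S≤U n = begin
        S n                  ≡⟨ sym (ℚ.+-identityʳ (S n)) ⟩
        S n + 0ℚ             ≤⟨ ℚ.+-monoʳ-≤ (S n) (0≤+ (s-nonNeg n) (s-nonNeg n)) ⟩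
        S n + (s n + s n)    ∎

      S-bound : ∀ n → K ℕ.≤ n → S n ≤ U K
      S-bound n K≤n = ℚ.≤-trans (S≤U n)
        (subst (λ m → U m ≤ U K) (ℕ.m∸n+n≡m K≤n) (U-antitone K (n ℕ.∸ K) ℕ.≤-refl))

      S-tail : ∀ n j → K ℕ.≤ n → S (suc (j ℕ.+ n)) - S (suc n) ≤ s (suc n) + s (suc n)
      S-tail n j K≤n = begin
        S (suc (j ℕ.+ n)) - S (suc n)
          ≤⟨ ℚ.+-monoˡ-≤ (- S (suc n)) (ℚ.≤-trans (S≤U (suc (j ℕ.+ n)))
               (subst (λ m → U m ≤ U (suc n)) (ℕ.+-suc j n) (U-antitone (suc n) j (ℕ.m≤n⇒m≤1+n K≤n)))) ⟩
        (S (suc n) + (s (suc n) + s (suc n))) - S (suc n)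
          ≡⟨ solve 2 (λ a b → (a :+ b) :- a := b) refl (S (suc n)) (s (suc n) + s (suc n)) ⟩
        s (suc n) + s (suc n) ∎

      s-tail-small : ∀ {ε} → 0ℚ < ε → ∃ λ N → K ℕ.≤ N × ∀ n → N ℕ.≤ n → s (suc n) + s (suc n) < ε
      s-tail-small {ε} 0<ε = K ℕ.+ N , ℕ.m≤m+n K N , small
        where
        C-small = recip-<ε {s K * B + s K * B} 0<ε
        N = proj₁ C-small
        sB≤ : ∀ n → K ℕ.+ N ℕ.≤ n → s n * B ≤ s K * B
        sB≤ n h = ℚ.*-monoʳ-≤-nonNeg B {{nonNegative 0≤B}}
          (subst (λ m → s m ≤ s K) (ℕ.m∸n+n≡m (ℕ.m+n≤o⇒m≤o K h)) (s-antitone (n ℕ.∸ K)))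
        small : ∀ n → K ℕ.+ N ℕ.≤ n → s (suc n) + s (suc n) < ε
        small n h = begin-strict
          recip n * (s n * B) + recip n * (s n * B)   ≡⟨ sym (ℚ.*-distribˡ-+ (recip n) (s n * B) (s n * B)) ⟩
          recip n * (s n * B + s n * B)               ≤⟨ ℚ.*-monoˡ-≤-nonNeg (recip n)
            {{nonNegative (recip-nonNeg n)}} (ℚ.+-mono-≤ (sB≤ n h) (sB≤ n h)) ⟩
          recip n * (s K * B + s K * B)               <⟨ proj₂ C-small n (ℕ.m+n≤o⇒n≤o K h) ⟩
          ε                                           ∎

  exp-seq : ℂ → ℕ → ℚ[i]
  exp-seq z n = expSum n (approx z n)

  approx-bounded : ∀ z → ∃ λ N → ∃ λ B → 0ℚ < B × (∀ n → N ℕ.≤ n → ‖ approx z n ‖ ≤ B)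
  approx-bounded z = combine (cauchy-bounded {seq (re z)} (cauchy (re z)))
                             (cauchy-bounded {seq (im z)} (cauchy (im z)))
    where
    combine : (∃ λ N → ∃ λ M → 0ℚ < M × EventuallyBoundedBy (seq (re z)) N M) →
              (∃ λ N → ∃ λ M → 0ℚ < M × EventuallyBoundedBy (seq (im z)) N M) →
              ∃ λ N → ∃ λ B → 0ℚ < B × (∀ n → N ℕ.≤ n → ‖ approx z n ‖ ≤ B)
    combine (N , M , 0<M , p) (N′ , M′ , 0<M′ , p′) =
      N ℕ.+ N′ , M + M′ , ℚ.+-mono-< 0<M 0<M′ , λ n h →
        ℚ.+-mono-≤ (p n (ℕ.m+n≤o⇒m≤o N h)) (p′ n (ℕ.m+n≤o⇒n≤o N h))

  approx-cauchy : ∀ z δ → 0ℚ < δ →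
    ∃ λ N → ∀ m n → N ℕ.≤ m → N ℕ.≤ n → ‖ approx z m ⊕ (⊖ approx z n) ‖ ≤ δ
  approx-cauchy z δ 0<δ = N ℕ.+ N′ , λ m n hm hn → ℚ.≤-trans
    (ℚ.+-mono-≤
      (ℚ.<⇒≤ (proj₂ cx m n (ℕ.m+n≤o⇒m≤o N hm) (ℕ.m+n≤o⇒m≤o N hn)))
      (ℚ.<⇒≤ (proj₂ cy m n (ℕ.m+n≤o⇒n≤o N hm) (ℕ.m+n≤o⇒n≤o N hn))))
    (ℚ.≤-reflexive (½+½ δ))
    where
    cx = cauchy (re z) (½ * δ) (½-positive 0<δ)
    cy = cauchy (im z) (½ * δ) (½-positive 0<δ)
    N  = proj₁ cx
    N′ = proj₁ cy

  module _ (B : ℚ) (0≤B : 0ℚ ≤ B) (K : ℕ) (2B≤K : B + B ≤ ι K) where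
    open Majorant B 0≤B
    open Tail K 2B≤K

    -- The distance between the diagonal sequence at m = j + n and at n.
    step : ∀ {ε M δ} n j z w → K ℕ.≤ n → ‖ z ‖ ≤ B → ‖ w ‖ ≤ B →
      U K ≤ M → 0ℚ ≤ M → ‖ z ⊕ (⊖ w) ‖ ≤ δ → M * δ ≡ ½ * ε →
      s (suc n) + s (suc n) < ½ * ε →
      ‖ expSum (j ℕ.+ n) z ⊕ (⊖ expSum n w) ‖ < ε
    step {ε} {M} {δ} n j z w K≤n hz hw U≤M 0≤M z≈w Mδ tail = begin-strict
      ‖ a ⊕ (⊖ c) ‖                   ≡⟨ cong ‖_‖ (cong₂ _+i_
        (telescope (re a) (re b) (re c)) (telescope (im a) (im b) (im c))) ⟩
      ‖ (a ⊕ (⊖ b)) ⊕ (b ⊕ (⊖ c)) ‖   ≤⟨ ‖⊕‖ (a ⊕ (⊖ b)) (b ⊕ (⊖ c)) ⟩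
      ‖ a ⊕ (⊖ b) ‖ + ‖ b ⊕ (⊖ c) ‖   <⟨ ℚ.+-mono-<-≤ tail-bound point-bound ⟩
      ½ * ε + ½ * ε                   ≡⟨ ½+½ ε ⟩
      ε                               ∎
      where
      a = expSum (j ℕ.+ n) z
      b = expSum n z
      c = expSum n w
      telescope : ∀ a b c → a + - c ≡ (a + - b) + (b + - c)
      telescope = solve 3 (λ a b c → a :+ :- c := (a :+ :- b) :+ (b :+ :- c)) refl
      tail-bound : ‖ a ⊕ (⊖ b) ‖ < ½ * ε
      tail-bound = ℚ.≤-<-trans (ℚ.≤-trans (sum-tail n j z hz) (S-tail n j K≤n)) tail
      point-bound : ‖ b ⊕ (⊖ c) ‖ ≤ ½ * ε
      point-bound = begin
        ‖ b ⊕ (⊖ c) ‖         ≤⟨ sum-lipschitz n z w hz hw ⟩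
        S n * ‖ z ⊕ (⊖ w) ‖   ≤⟨ ℚ.*-monoʳ-≤-nonNeg ‖ z ⊕ (⊖ w) ‖
          {{nonNegative (‖‖-nonNeg (z ⊕ (⊖ w)))}} (ℚ.≤-trans (S-bound n K≤n) U≤M) ⟩
        M * ‖ z ⊕ (⊖ w) ‖     ≤⟨ ℚ.*-monoˡ-≤-nonNeg M {{nonNegative 0≤M}} z≈w ⟩
        M * δ                 ≡⟨ Mδ ⟩
        ½ * ε                 ∎

    module _ (z : ℂ) (N₀ : ℕ) (bound : ∀ n → N₀ ℕ.≤ n → ‖ approx z n ‖ ≤ B)
             {ε : ℚ} (M : ℚ) (U≤M : U K ≤ M) (0≤M : 0ℚ ≤ M)
             (δ : ℚ) (Mδ : M * δ ≡ ½ * ε)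
             (N₁ : ℕ) (close : ∀ m n → N₁ ℕ.≤ m → N₁ ℕ.≤ n → ‖ approx z m ⊕ (⊖ approx z n) ‖ ≤ δ)
             (N₂ : ℕ) (K≤N₂ : K ℕ.≤ N₂) (tail : ∀ n → N₂ ℕ.≤ n → s (suc n) + s (suc n) < ½ * ε)
             where

      N : ℕ
      N = N₀ ℕ.+ (N₁ ℕ.+ N₂)

      N₀≤ : ∀ {n} → N ℕ.≤ n → N₀ ℕ.≤ n
      N₀≤ = ℕ.m+n≤o⇒m≤o N₀

      N₁≤ : ∀ {n} → N ℕ.≤ n → N₁ ℕ.≤ n
      N₁≤ h = ℕ.m+n≤o⇒m≤o N₁ (ℕ.m+n≤o⇒n≤o N₀ h)

      N₂≤ : ∀ {n} → N ℕ.≤ n → N₂ ℕ.≤ n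
      N₂≤ h = ℕ.m+n≤o⇒n≤o N₁ (ℕ.m+n≤o⇒n≤o N₀ h)

      ordered : ∀ m n → N ℕ.≤ n → n ℕ.≤ m → ‖ exp-seq z m ⊕ (⊖ exp-seq z n) ‖ < ε
      ordered m n hn n≤m = subst (λ k → ‖ expSum k (approx z m) ⊕ (⊖ exp-seq z n) ‖ < ε)
        (ℕ.m∸n+n≡m n≤m)
        (step n (m ℕ.∸ n) (approx z m) (approx z n) (ℕ.≤-trans K≤N₂ (N₂≤ hn))
          (bound m (N₀≤ hm)) (bound n (N₀≤ hn)) U≤M 0≤M (close m n (N₁≤ hm) (N₁≤ hn)) Mδ
          (tail n (N₂≤ hn)))
        where
        hm : N ℕ.≤ m
        hm = ℕ.≤-trans hn n≤m

      unordered : ∀ m n → N ℕ.≤ m → N ℕ.≤ n → ‖ exp-seq z m ⊕ (⊖ exp-seq z n) ‖ < ε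
      unordered m n hm hn = go (ℕ.≤-total n m)
        where
        go : n ℕ.≤ m ⊎ m ℕ.≤ n → ‖ exp-seq z m ⊕ (⊖ exp-seq z n) ‖ < ε
        go (inj₁ n≤m) = ordered m n hn n≤m
        go (inj₂ m≤n) = subst (_< ε)
          (cong₂ _+_ (∣-∣-comm (re (exp-seq z n)) (re (exp-seq z m)))
                     (∣-∣-comm (im (exp-seq z n)) (im (exp-seq z m))))
          (ordered n m hm m≤n)

    exp-cauchy-bounded : ∀ z N₀ → (∀ n → N₀ ℕ.≤ n → ‖ approx z n ‖ ≤ B) → ∀ ε → 0ℚ < ε →
      ∃ λ N → ∀ m n → N ℕ.≤ m → N ℕ.≤ n → ‖ exp-seq z m ⊕ (⊖ exp-seq z n) ‖ < ε
    exp-cauchy-bounded z N₀ bound ε 0<ε = from-quotient (quotient 0<M (½-positive 0<ε))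
      where
      0≤S : ∀ n → 0ℚ ≤ S n
      0≤S zero    = ℚ.≤-refl
      0≤S (suc n) = 0≤+ (0≤S n) (s-nonNeg n)
      M : ℚ
      M = 1ℚ + U K
      0<M : 0ℚ < M
      0<M = 1+-positive (ℚ.≤-trans (0≤S K) (S≤U K))
      U≤M : U K ≤ M
      U≤M = ℚ.≤-trans (ℚ.≤-reflexive (sym (ℚ.+-identityˡ (U K))))
        (ℚ.+-monoˡ-≤ (U K) (ℚ.<⇒≤ (ℚ.positive⁻¹ 1ℚ)))
      Goal = ∃ λ N → ∀ m n → N ℕ.≤ m → N ℕ.≤ n → ‖ exp-seq z m ⊕ (⊖ exp-seq z n) ‖ < ε
      from-quotient : (∃ λ δ → 0ℚ < δ × M * δ ≡ ½ * ε) → Goal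
      from-quotient (δ , 0<δ , Mδ) =
        from-moduli (approx-cauchy z δ 0<δ) (s-tail-small (½-positive 0<ε))
        where
        from-moduli :
          (∃ λ N → ∀ m n → N ℕ.≤ m → N ℕ.≤ n → ‖ approx z m ⊕ (⊖ approx z n) ‖ ≤ δ) →
          (∃ λ N → K ℕ.≤ N × ∀ n → N ℕ.≤ n → s (suc n) + s (suc n) < ½ * ε) → Goal
        from-moduli (N₁ , close) (N₂ , K≤N₂ , tail) = _ ,
          unordered z N₀ bound M U≤M (ℚ.<⇒≤ 0<M) δ Mδ N₁ close N₂ K≤N₂ tail

  exp-cauchy : ∀ z ε → 0ℚ < ε →
    ∃ λ N → ∀ m n → N ℕ.≤ m → N ℕ.≤ n → ‖ exp-seq z m ⊕ (⊖ exp-seq z n) ‖ < ε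
  exp-cauchy z = from-bound (approx-bounded z)
    where
    from-bound : (∃ λ N → ∃ λ B → 0ℚ < B × (∀ n → N ℕ.≤ n → ‖ approx z n ‖ ≤ B)) →
      ∀ ε → 0ℚ < ε →
      ∃ λ N → ∀ m n → N ℕ.≤ m → N ℕ.≤ n → ‖ exp-seq z m ⊕ (⊖ exp-seq z n) ‖ < ε
    from-bound (N₀ , B , 0<B , bound) = exp-cauchy-bounded B (ℚ.<⇒≤ 0<B)
      (proj₁ (archimedean (B + B))) (proj₂ (archimedean (B + B))) z N₀ bound

  ∣re∣≤‖‖ : ∀ z → ∣ re z ∣ ≤ ‖ z ‖
  ∣re∣≤‖‖ z = ℚ.≤-trans (ℚ.≤-reflexive (sym (ℚ.+-identityʳ (∣ re z ∣))))
    (ℚ.+-monoʳ-≤ (∣ re z ∣) (ℚ.0≤∣p∣ (im z)))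

  ∣im∣≤‖‖ : ∀ z → ∣ im z ∣ ≤ ‖ z ‖
  ∣im∣≤‖‖ z = ℚ.≤-trans (ℚ.≤-reflexive (sym (ℚ.+-identityˡ (∣ im z ∣))))
    (ℚ.+-monoˡ-≤ (∣ im z ∣) (ℚ.0≤∣p∣ (re z)))

  abstract

    exp-re-cauchy : ∀ z → IsCauchy (λ n → re (exp-seq z n))
    exp-re-cauchy z ε 0<ε = proj₁ (exp-cauchy z ε 0<ε) , λ m n hm hn →
      ℚ.≤-<-trans (∣re∣≤‖‖ (exp-seq z m ⊕ (⊖ exp-seq z n))) (proj₂ (exp-cauchy z ε 0<ε) m n hm hn)

    exp-im-cauchy : ∀ z → IsCauchy (λ n → im (exp-seq z n))
    exp-im-cauchy z ε 0<ε = proj₁ (exp-cauchy z ε 0<ε) , λ m n hm hn →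
      ℚ.≤-<-trans (∣im∣≤‖‖ (exp-seq z m ⊕ (⊖ exp-seq z n))) (proj₂ (exp-cauchy z ε 0<ε) m n hm hn)

-- The diagonal sequence Σ_{k ≤ n} zₙ ^ k / k !, where zₙ ∈ ℚ[i] is the n-th
-- approximation of z; it has the same limit as the power series at z because
-- the partial sums are uniformly Lipschitz on bounded sets.
exp : ℂ → ℂ
exp z = mkℝ (λ n → re (expSum n (approx z n))) (Exp-Lemmas.exp-re-cauchy z)
     +i mkℝ (λ n → im (expSum n (approx z n))) (Exp-Lemmas.exp-im-cauchy z)

cis : ℝ → ℂ
cis α = exp (ℂ.imaginary α)

cos : ℝ → ℝ
cos x = re (cis x)

-- π/2 is the least positive zero of cos.
record IsPi (π : ℝ) : Set where
  field
    positive : 0ℝ <ʳ π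
    cos[π/2] : cos (fromℚ ½ *ʳ π) ≈ʳ 0ℝ
    least    : ∀ x → 0ℝ <ʳ x → x <ʳ fromℚ ½ *ʳ π → ¬ cos x ≈ʳ 0ℝ

infix  4 _≋_
infixr 7 _•_
infixl 7 _⊙_

_≋_ : ∀ {n} → Vector ℂ n → Vector ℂ n → Set
u ≋ v = ∀ k → u k ≈ᶜ v k

_•_ : ∀ {n} → ℂ → Vector ℂ n → Vector ℂ n
(c • v) k = c *ᶜ v k

_⊙_ : ∀ {n} → Vector ℂ n → Vector ℂ n → Vector ℂ n
(u ⊙ v) k = u k *ᶜ v k

⟨_,_⟩ : ∀ {n} → Vector ℂ n → Vector ℂ n → ℂ
⟨ u , v ⟩ = ℂ.sum (λ k → ℂ.conj (u k) *ᶜ v k)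

linearCombination : ∀ {m n} → Vector ℂ m → Vector (Vector ℂ n) m → Vector ℂ n
linearCombination c b k = ℂ.sum (λ j → c j *ᶜ b j k)

LinearlyIndependent : ∀ {m n} → Vector (Vector ℂ n) m → Set
LinearlyIndependent b = ∀ c → linearCombination c b ≋ (λ _ → 0ℂ) → ∀ j → c j ≈ᶜ 0ℂ

Spanning : ∀ {m n} → Vector (Vector ℂ n) m → Set
Spanning b = ∀ v → ∃ λ c → linearCombination c b ≋ v

IsUnit : ∀ {n} → Vector ℂ n → Set
IsUnit v = ⟨ v , v ⟩ ≈ᶜ 1ℂ

record IsOrthonormalBasis {m n} (b : Vector (Vector ℂ n) m) : Set where
  field
    unit                : ∀ j → IsUnit (b j)
    orthogonal          : ∀ j k → j ≢ k → ⟨ b j , b k ⟩ ≈ᶜ 0ℂ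
    linearlyIndependent : LinearlyIndependent b
    spanning            : Spanning b

Array : ℕ → Set
Array n = Fin n → Fin n → Vector ℂ n

record IsQuantumLatinSquare {n} (Φ : Array n) : Set where
  field
    unit    : ∀ i j → IsUnit (Φ i j)
    rows    : ∀ i → IsOrthonormalBasis (λ j → Φ i j)
    columns : ∀ j → IsOrthonormalBasis (λ i → Φ i j)

infix 4 _∼_

_∼_ : ∀ {n} → Vector ℂ n → Vector ℂ n → Set
u ∼ v = ∃ λ α → u ≋ cis α • v

SameClass : ∀ {n} → Array n → Fin n × Fin n → Fin n × Fin n → Set
SameClass Φ (i , j) (k , l) = Φ i j ∼ Φ k l

-- A bijection from Fin c onto the positions modulo phase equivalence of entries.
HasCardinality : ∀ {n} → Array n → ℕ → Set
HasCardinality {n} Φ c = ∃ λ (f : Fin c → Fin n × Fin n) → Bijective _≡_ (SameClass Φ) f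

-- Residues modulo 8, represented by 0, …, 7.
A : Vec (Vec (Fin 8) 6) 6
A = (# 0 ∷ # 0 ∷ # 0 ∷ # 0 ∷ # 0 ∷ # 0 ∷ [])
  ∷ (# 0 ∷ # 4 ∷ # 2 ∷ # 6 ∷ # 6 ∷ # 2 ∷ [])
  ∷ (# 0 ∷ # 2 ∷ # 4 ∷ # 3 ∷ # 7 ∷ # 6 ∷ [])
  ∷ (# 0 ∷ # 6 ∷ # 1 ∷ # 4 ∷ # 2 ∷ # 5 ∷ [])
  ∷ (# 0 ∷ # 6 ∷ # 5 ∷ # 2 ∷ # 4 ∷ # 1 ∷ [])
  ∷ (# 0 ∷ # 2 ∷ # 6 ∷ # 7 ∷ # 3 ∷ # 4 ∷ [])
  ∷ []

module _ (π : ℝ) where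

  ζ : ℂ
  ζ = cis (fromℚ (+ 1 / 4) *ʳ π)

  H : Fin 6 → Fin 6 → ℂ
  H r s = ζ ℂ.^ toℕ (Vec.lookup (Vec.lookup A r) s)

  column : Fin 6 → Vector ℂ 6
  column s r = H r s

  Φ₁₉ : Array 6
  Φ₁₉ i j = ℂ.real (1/√ 6) • (column i ⊙ column j)

{-# OPTIONS --safe #-}
module Submission where

-- The exponential of Cauchy sequences satisfies exp z exp w ≈ exp (z + w): the
-- product of two partial sums differs from the partial sum at z + w only in
-- terms of degree exceeding n.  Hence w = cis (π/2), which has real part 0 and
-- satisfies w̄ w = 1, has square −1, and ζ = cis (π/4) satisfies ζ⁴ = −1 and
-- ζ̄ = ζ⁷.  Inner products of entries of Φ₁₉ are then (1/6) Σ ζ^e, and the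
-- orthogonality relations of rows and columns hold already in ℚ[x] / (x⁴ + 1).
-- As row 0 of A vanishes, phase equivalent entries are equal; since 1, ζ, …,
-- ζ⁷ are distinct, the classes correspond to the vectors of exponents modulo 8.

open import Algebra.Bundles using (CommutativeRing)
open import Algebra.Bundles.Raw using (RawRing)
open import Algebra.Solver.Ring.AlmostCommutativeRing using (fromCommutativeRing)
import Algebra.Solver.Ring.Simple as RingSolver
open import Algebra.Structures using (IsCommutativeRing)
open import Data.Bool.Base using (if_then_else_; true; false)
open import Data.Empty using (⊥; ⊥-elim)
open import Data.Fin using (Fin; zero; suc; toℕ; #_)
import Data.Fin.Properties as F
open import Data.Integer.Base as ℤ using (+_)
import Data.Integer.Properties as ℤ
open import Data.Nat.Base as ℕ using (ℕ; zero; suc; _!)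
open import Data.Nat.DivMod as ℕ using (_mod_)
open import Data.Nat.Properties as ℕ using (_!≢0)
open import Data.Product.Base using (∃; _×_; _,_; proj₁; proj₂)
open import Data.Rational.Base as ℚ using (ℚ; 0ℚ; 1ℚ; ½; nonNegative; positive)
import Data.Rational.Properties as ℚ
import Data.Rational.Solver as ℚSolver
open import Data.Rational.Unnormalised.Base as ℚᵘ using (mkℚᵘ)
open import Data.Sum.Base using (_⊎_; inj₁; inj₂)
open import Data.Vec.Base as Vec using (Vec; []; _∷_)
open import Data.Vec.Functional using (Vector)
import Data.Vec.Properties as Vec
open import Function.Base using (_∘_)
open import Level using (0ℓ)
open import Relation.Binary.Definitions using (DecidableEquality)
open import Relation.Binary.PropositionalEquality
  using (_≡_; _≢_; refl; sym; trans; cong; cong₂; subst; subst₂; isEquivalence; module ≡-Reasoning)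
open import Relation.Nullary using (¬_; Dec)
open import Relation.Nullary.Decidable
  using (does; dec-true; dec-false; from-yes; from-no; map′; _×-dec_; _⊎-dec_; _→-dec_)
open import Defs

open ℚ-Lemmas
open Cauchy-Lemmas
open Exp-Lemmas
open RawRing ℚ[i].rawRing using () renaming (_+_ to _⊕_; _*_ to _⊗_; -_ to ⊖_; 0# to 0ℚ[i]; 1# to 1ℚ[i])

-- `exp` is a diagonal sequence: its n-th term evaluates the n-th partial sum at the n-th
-- approximation of the argument. The product rule therefore has to be an estimate uniform over a
-- ball, with arguments that move with n. The error is at most `S (suc n)` squared over 2ⁿ, where
-- `S` is a bounded majorant of doubled radius. Conversely, an identity that holds term by term in
-- ℚ[i] passes to ℂ at once. So the ring laws of ℂ, the rule for conjugation and all solver steps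
-- are inherited pointwise, and limits enter mainly through congruence, the product rule and √6. The
-- combinatorial part is stated for any z with z⁴ = -1 and z̄ z = 1, that is, for every primitive
-- eighth root of unity; the sign of w = ±i does not affect it. An orthonormal basis here includes
-- independence and spanning, so for the matrix B of each row and each column both B* B = 1 and B B*
-- = 1 are verified.

-- The ring of Gaussian rationals

ℚ[i]-isCommutativeRing : IsCommutativeRing _≡_ _⊕_ _⊗_ ⊖_ 0ℚ[i] 1ℚ[i]
ℚ[i]-isCommutativeRing = record
  { isRing = record
    { +-isAbelianGroup = record
      { isGroup = record
        { isMonoid = record
          { isSemigroup = record
            { isMagma = record { isEquivalence = isEquivalence ; ∙-cong = cong₂ _⊕_ }
            ; assoc   = λ z w v → cong₂ _+i_ (ℚ.+-assoc (re z) (re w) (re v)) (ℚ.+-assoc (im z) (im w) (im v))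
            }
          ; identity = (λ z → cong₂ _+i_ (ℚ.+-identityˡ (re z)) (ℚ.+-identityˡ (im z)))
                     , (λ z → cong₂ _+i_ (ℚ.+-identityʳ (re z)) (ℚ.+-identityʳ (im z)))
          }
        ; inverse = (λ z → cong₂ _+i_ (ℚ.+-inverseˡ (re z)) (ℚ.+-inverseˡ (im z)))
                  , (λ z → cong₂ _+i_ (ℚ.+-inverseʳ (re z)) (ℚ.+-inverseʳ (im z)))
        ; ⁻¹-cong = cong ⊖_
        }
      ; comm = λ z w → cong₂ _+i_ (ℚ.+-comm (re z) (re w)) (ℚ.+-comm (im z) (im w))
      }
    ; *-cong     = cong₂ _⊗_
    ; *-assoc    = λ { (a +i b) (c +i d) (e +i f) → cong₂ _+i_
        (solve 6 (λ a b c d e f →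
          (a :* c :+ :- (b :* d)) :* e :+ :- ((a :* d :+ b :* c) :* f) :=
          a :* (c :* e :+ :- (d :* f)) :+ :- (b :* (c :* f :+ d :* e))) refl a b c d e f)
        (solve 6 (λ a b c d e f →
          (a :* c :+ :- (b :* d)) :* f :+ (a :* d :+ b :* c) :* e :=
          a :* (c :* f :+ d :* e) :+ b :* (c :* e :+ :- (d :* f))) refl a b c d e f) }
    ; *-identity = (λ { (a +i b) → cong₂ _+i_
                     (solve 2 (λ a b → con 1ℚ :* a :+ :- (con 0ℚ :* b) := a) refl a b)
                     (solve 2 (λ a b → con 1ℚ :* b :+ con 0ℚ :* a := b) refl a b) })
                 , (λ { (a +i b) → cong₂ _+i_
                     (solve 2 (λ a b → a :* con 1ℚ :+ :- (b :* con 0ℚ) := a) refl a b)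
                     (solve 2 (λ a b → a :* con 0ℚ :+ b :* con 1ℚ := b) refl a b) })
    ; distrib    = (λ { (a +i b) (c +i d) (e +i f) → cong₂ _+i_
                     (solve 6 (λ a b c d e f →
                       a :* (c :+ e) :+ :- (b :* (d :+ f)) :=
                       (a :* c :+ :- (b :* d)) :+ (a :* e :+ :- (b :* f))) refl a b c d e f)
                     (solve 6 (λ a b c d e f →
                       a :* (d :+ f) :+ b :* (c :+ e) :=
                       (a :* d :+ b :* c) :+ (a :* f :+ b :* e)) refl a b c d e f) })
                 , (λ { (a +i b) (c +i d) (e +i f) → cong₂ _+i_
                     (solve 6 (λ a b c d e f →
                       (c :+ e) :* a :+ :- ((d :+ f) :* b) :=
                       (c :* a :+ :- (d :* b)) :+ (e :* a :+ :- (f :* b))) refl a b c d e f)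
                     (solve 6 (λ a b c d e f →
                       (c :+ e) :* b :+ (d :+ f) :* a :=
                       (c :* b :+ d :* a) :+ (e :* b :+ f :* a)) refl a b c d e f) })
    }
  ; *-comm = λ { (a +i b) (c +i d) → cong₂ _+i_
      (solve 4 (λ a b c d → a :* c :+ :- (b :* d) := c :* a :+ :- (d :* b)) refl a b c d)
      (solve 4 (λ a b c d → a :* d :+ b :* c := c :* b :+ d :* a) refl a b c d) }
  }
  where open ℚSolver.+-*-Solver

ℚ[i]-commutativeRing : CommutativeRing 0ℓ 0ℓ
ℚ[i]-commutativeRing = record { isCommutativeRing = ℚ[i]-isCommutativeRing }

private module Q = CommutativeRing ℚ[i]-commutativeRing

_≟_ : DecidableEquality ℚ[i]
z ≟ w = map′ (λ (p , q) → cong₂ _+i_ p q) (λ eq → cong re eq , cong im eq)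
  (re z ℚ.≟ re w ×-dec im z ℚ.≟ im w)

module ℚ[i]-Solver = RingSolver (fromCommutativeRing ℚ[i]-commutativeRing) _≟_

-- Equality of Cauchy sequences

≈ʳ-pointwise : ∀ {x y} → (∀ n → seq x n ≡ seq y n) → x ≈ʳ y
≈ʳ-pointwise {x} {y} eq ε 0<ε = 0 , λ n _ → subst (λ p → ℚ.∣ p ∣ ℚ.< ε)
  (sym (trans (cong (ℚ._- seq y n) (eq n)) (ℚ.+-inverseʳ (seq y n)))) 0<ε

≈ʳ-sym : ∀ {x y} → x ≈ʳ y → y ≈ʳ x
≈ʳ-sym {x} {y} p ε 0<ε with p ε 0<ε
... | N , h = N , λ n N≤n → subst (ℚ._< ε) (∣-∣-comm (seq x n) (seq y n)) (h n N≤n)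

≈ʳ-trans : ∀ {x y z} → x ≈ʳ y → y ≈ʳ z → x ≈ʳ z
≈ʳ-trans {x} {y} {z} p q ε 0<ε = proj₁ h ℕ.+ proj₁ h′ , λ n le → begin-strict
  ∣ seq x n - seq z n ∣                             ≡⟨ cong ∣_∣ (telescope (seq x n) (seq y n) (seq z n)) ⟩
  ∣ (seq x n - seq y n) + (seq y n - seq z n) ∣     ≤⟨ ℚ.∣p+q∣≤∣p∣+∣q∣ (seq x n - seq y n) (seq y n - seq z n) ⟩
  ∣ seq x n - seq y n ∣ + ∣ seq y n - seq z n ∣     <⟨ ℚ.+-mono-< (proj₂ h n (ℕ.m+n≤o⇒m≤o (proj₁ h) le))
                                                                  (proj₂ h′ n (ℕ.m+n≤o⇒n≤o (proj₁ h) le)) ⟩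
  ½ * ε + ½ * ε                                     ≡⟨ ½+½ ε ⟩
  ε                                                 ∎
  where
  open import Data.Rational.Base
  open ℚSolver.+-*-Solver
  open ℚ.≤-Reasoning
  h  = p (½ * ε) (½-positive 0<ε)
  h′ = q (½ * ε) (½-positive 0<ε)
  telescope : ∀ a b c → a - c ≡ (a - b) + (b - c)
  telescope = solve 3 (λ a b c → a :- c := (a :- b) :+ (b :- c)) refl

+ʳ-cong : ∀ {x x′ y y′} → x ≈ʳ x′ → y ≈ʳ y′ → x +ʳ y ≈ʳ x′ +ʳ y′
+ʳ-cong {x} {x′} {y} {y′} p q ε 0<ε = proj₁ h ℕ.+ proj₁ h′ , λ n le → ℚ.≤-<-trans
  (∣+-+∣ (seq x n) (seq y n) (seq x′ n) (seq y′ n))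
  (ℚ.<-≤-trans (ℚ.+-mono-< (proj₂ h n (ℕ.m+n≤o⇒m≤o (proj₁ h) le)) (proj₂ h′ n (ℕ.m+n≤o⇒n≤o (proj₁ h) le)))
    (ℚ.≤-reflexive (½+½ ε)))
  where
  h  = p (½ ℚ.* ε) (½-positive 0<ε)
  h′ = q (½ ℚ.* ε) (½-positive 0<ε)

-ʳ-cong : ∀ {x y} → x ≈ʳ y → -ʳ x ≈ʳ -ʳ y
-ʳ-cong {x} {y} p ε 0<ε = proj₁ (p ε 0<ε) , λ n N≤n → subst (ℚ._< ε)
  (trans (sym (ℚ.∣-p∣≡∣p∣ (seq x n ℚ.- seq y n))) (cong ℚ.∣_∣ (ℚ.neg-distrib-+ (seq x n) (ℚ.- seq y n))))
  (proj₂ (p ε 0<ε) n N≤n)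

*ʳ-cong : ∀ {x x′ y y′} → x ≈ʳ x′ → y ≈ʳ y′ → x *ʳ y ≈ʳ x′ *ʳ y′
*ʳ-cong {x} {x′} {y} {y′} p q ε 0<ε =
  from-bounds (cauchy-bounded {seq x} (cauchy x)) (cauchy-bounded {seq y′} (cauchy y′))
  where
  open import Data.Rational.Base
  open ℚ.≤-Reasoning
  Goal : Set
  Goal = ∃ λ N → ∀ n → N ℕ.≤ n → ∣ seq x n * seq y n - seq x′ n * seq y′ n ∣ < ε
  from-bounds : (∃ λ K → ∃ λ M → 0ℚ < M × EventuallyBoundedBy (seq x) K M) →
                (∃ λ K → ∃ λ M → 0ℚ < M × EventuallyBoundedBy (seq y′) K M) → Goal
  from-bounds (K , M , 0<M , bx) (K′ , M′ , 0<M′ , by) =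
    from-quotients (quotient 0<M (½-positive 0<ε)) (quotient 0<M′ (½-positive 0<ε))
    where
    from-quotients : (∃ λ δ → 0ℚ < δ × M * δ ≡ ½ * ε) → (∃ λ δ → 0ℚ < δ × M′ * δ ≡ ½ * ε) → Goal
    from-quotients (δ , 0<δ , Mδ) (δ′ , 0<δ′ , M′δ′) = from-moduli (q δ 0<δ) (p δ′ 0<δ′)
      where
      from-moduli : (∃ λ N → ∀ n → N ℕ.≤ n → ∣ seq y n - seq y′ n ∣ < δ) →
                    (∃ λ N → ∀ n → N ℕ.≤ n → ∣ seq x n - seq x′ n ∣ < δ′) → Goal
      from-moduli (N , h) (N′ , h′) = (K ℕ.+ K′) ℕ.+ (N ℕ.+ N′) , bound
        where
        bound : ∀ n → (K ℕ.+ K′) ℕ.+ (N ℕ.+ N′) ℕ.≤ n → ∣ seq x n * seq y n - seq x′ n * seq y′ n ∣ < ε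
        bound n le = begin-strict
          ∣ a * b - c * d ∣                       ≤⟨ ∣*-*∣ a b c d ⟩
          ∣ a ∣ * ∣ b - d ∣ + ∣ d ∣ * ∣ a - c ∣   ≤⟨ ℚ.+-mono-≤
            (ℚ.*-monoʳ-≤-nonNeg ∣ b - d ∣ {{ℚ.∣-∣-nonNeg (b - d)}} (bx n (ℕ.m+n≤o⇒m≤o K KK′≤)))
            (ℚ.*-monoʳ-≤-nonNeg ∣ a - c ∣ {{ℚ.∣-∣-nonNeg (a - c)}} (by n (ℕ.m+n≤o⇒n≤o K KK′≤))) ⟩
          M * ∣ b - d ∣ + M′ * ∣ a - c ∣          <⟨ ℚ.+-mono-<
            (ℚ.*-monoʳ-<-pos M {{positive 0<M}} (h n (ℕ.m+n≤o⇒m≤o N NN′≤)))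
            (ℚ.*-monoʳ-<-pos M′ {{positive 0<M′}} (h′ n (ℕ.m+n≤o⇒n≤o N NN′≤))) ⟩
          M * δ + M′ * δ′                         ≡⟨ cong₂ _+_ Mδ M′δ′ ⟩
          ½ * ε + ½ * ε                           ≡⟨ ½+½ ε ⟩
          ε                                       ∎
          where
          KK′≤ = ℕ.m+n≤o⇒m≤o (K ℕ.+ K′) le
          NN′≤ = ℕ.m+n≤o⇒n≤o (K ℕ.+ K′) le
          a = seq x n
          b = seq y n
          c = seq x′ n
          d = seq y′ n

-- The ring of complex numbers

-- Unlike _≈ᶜ_, this record determines z and w, so that they can be left implicit.
infix 4 _≃_

record _≃_ (z w : ℂ) : Set where
  constructor wrap
  field unwrap : z ≈ᶜ w

open _≃_

≃-pointwise : ∀ {z w} → (∀ n → approx z n ≡ approx w n) → z ≃ w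
≃-pointwise {z} {w} eq = wrap
  (≈ʳ-pointwise {re z} {re w} (cong re ∘ eq) , ≈ʳ-pointwise {im z} {im w} (cong im ∘ eq))

≃-limit : ∀ {z w} → (∀ ε → 0ℚ ℚ.< ε → ∃ λ N → ∀ n → N ℕ.≤ n →
          ‖ approx z n ⊕ (⊖ approx w n) ‖ ℚ.< ε) → z ≃ w
≃-limit {z} {w} lim = wrap
  ( (λ ε 0<ε → let N , h = lim ε 0<ε in N , λ n le →
      ℚ.≤-<-trans (∣re∣≤‖‖ (approx z n ⊕ (⊖ approx w n))) (h n le))
  , (λ ε 0<ε → let N , h = lim ε 0<ε in N , λ n le →
      ℚ.≤-<-trans (∣im∣≤‖‖ (approx z n ⊕ (⊖ approx w n))) (h n le)))

ℂ-isCommutativeRing : IsCommutativeRing _≃_ _+ᶜ_ _*ᶜ_ -ᶜ_ 0ℂ 1ℂ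
ℂ-isCommutativeRing = record
  { isRing = record
    { +-isAbelianGroup = record
      { isGroup = record
        { isMonoid = record
          { isSemigroup = record
            { isMagma = record
              { isEquivalence = record
                { refl  = ≃-pointwise (λ _ → refl)
                ; sym   = λ { {z} {w} (wrap (p , q)) → wrap
                    (≈ʳ-sym {re z} {re w} p , ≈ʳ-sym {im z} {im w} q) }
                ; trans = λ { {z} {w} {v} (wrap (p , q)) (wrap (p′ , q′)) → wrap
                    (≈ʳ-trans {re z} {re w} {re v} p p′ , ≈ʳ-trans {im z} {im w} {im v} q q′) }
                }
              ; ∙-cong = λ { {z} {z′} {w} {w′} (wrap (p , q)) (wrap (p′ , q′)) → wrap
                  (+ʳ-cong {re z} {re z′} {re w} {re w′} p p′ , +ʳ-cong {im z} {im z′} {im w} {im w′} q q′) }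
              }
            ; assoc = λ z w v → ≃-pointwise (λ n → Q.+-assoc (approx z n) (approx w n) (approx v n))
            }
          ; identity = (λ z → ≃-pointwise (Q.+-identityˡ ∘ approx z))
                     , (λ z → ≃-pointwise (Q.+-identityʳ ∘ approx z))
          }
        ; inverse = (λ z → ≃-pointwise (Q.-‿inverseˡ ∘ approx z))
                  , (λ z → ≃-pointwise (Q.-‿inverseʳ ∘ approx z))
        ; ⁻¹-cong = λ { {z} {w} (wrap (p , q)) → wrap (-ʳ-cong {re z} {re w} p , -ʳ-cong {im z} {im w} q) }
        }
      ; comm = λ z w → ≃-pointwise (λ n → Q.+-comm (approx z n) (approx w n))
      }
    ; *-cong = λ { {z} {z′} {w} {w′} (wrap (p , q)) (wrap (p′ , q′)) → wrap
        ( +ʳ-cong {re z *ʳ re w} {re z′ *ʳ re w′} { -ʳ (im z *ʳ im w)} { -ʳ (im z′ *ʳ im w′)}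
            (*ʳ-cong {re z} {re z′} {re w} {re w′} p p′)
            (-ʳ-cong {im z *ʳ im w} {im z′ *ʳ im w′} (*ʳ-cong {im z} {im z′} {im w} {im w′} q q′))
        , +ʳ-cong {re z *ʳ im w} {re z′ *ʳ im w′} {im z *ʳ re w} {im z′ *ʳ re w′}
            (*ʳ-cong {re z} {re z′} {im w} {im w′} p q′) (*ʳ-cong {im z} {im z′} {re w} {re w′} q p′)) }
    ; *-assoc = λ z w v → ≃-pointwise (λ n → Q.*-assoc (approx z n) (approx w n) (approx v n))
    ; *-identity = (λ z → ≃-pointwise (Q.*-identityˡ ∘ approx z))
                 , (λ z → ≃-pointwise (Q.*-identityʳ ∘ approx z))
    ; distrib = (λ z w v → ≃-pointwise (λ n → Q.distribˡ (approx z n) (approx w n) (approx v n)))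
              , (λ z w v → ≃-pointwise (λ n → Q.distribʳ (approx z n) (approx w n) (approx v n)))
    }
  ; *-comm = λ z w → ≃-pointwise (λ n → Q.*-comm (approx z n) (approx w n))
  }

ℂ-commutativeRing : CommutativeRing 0ℓ 0ℓ
ℂ-commutativeRing = record { isCommutativeRing = ℂ-isCommutativeRing }

private module C = CommutativeRing ℂ-commutativeRing

open import Algebra.Properties.Semiring.Exp C.semiring using (_^_; ^-congˡ; ^-homo-*; ^-assocʳ)

-- The exponential is a homomorphism

-- Σ g i k over i + k = j + l with i ≥ j.
antidiagonal : (ℕ → ℕ → ℚ[i]) → ℕ → ℕ → ℚ[i]
antidiagonal g j zero    = g j zero
antidiagonal g j (suc l) = g j (suc l) ⊕ antidiagonal g (suc j) l

-- `antidiagonal` peels off the smallest index, `expSum` the largest. When the summand depends on i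
-- alone, the new term can be moved to the other end.
antidiagonal-const : ∀ (f : ℕ → ℚ[i]) j l → antidiagonal (λ i _ → f i) j (suc l) ≡
                     antidiagonal (λ i _ → f i) j l ⊕ f (suc l ℕ.+ j)
antidiagonal-const f j zero    = refl
antidiagonal-const f j (suc l) = trans
  (cong (f j ⊕_) (trans (antidiagonal-const f (suc j) l)
    (cong (λ k → antidiagonal (λ i _ → f i) (suc j) l ⊕ f k) (ℕ.+-suc (suc l) j))))
  (sym (Q.+-assoc (f j) (antidiagonal (λ i _ → f i) (suc j) l) (f (suc (suc l) ℕ.+ j))))

antidiagonal-expTerm : ∀ z (c : ℚ[i]) n → antidiagonal (λ i _ → expTerm i z ⊗ c) 0 n ≡ expSum n z ⊗ c
antidiagonal-expTerm z c zero    = refl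
antidiagonal-expTerm z c (suc n) = trans (antidiagonal-const (λ i → expTerm i z ⊗ c) 0 n)
  (trans (cong₂ (λ u k → u ⊕ expTerm k z ⊗ c) (antidiagonal-expTerm z c n) (ℕ.+-identityʳ (suc n)))
    (sym (Q.distribʳ c (expSum n z) (expTerm (suc n) z))))

-- Square minus triangle: with a i = zⁱ/i!, c the full partial sum at w and b k its truncation at
-- degree k = n - i, row i of the error is a i times the tail c - b k.
antidiagonal-difference : ∀ (a : ℕ → ℚ[i]) (c : ℚ[i]) (b : ℕ → ℚ[i]) j l →
  antidiagonal (λ i k → a i ⊗ (c ⊕ (⊖ b k))) j l ≡
  antidiagonal (λ i _ → a i ⊗ c) j l ⊕ (⊖ antidiagonal (λ i k → a i ⊗ b k) j l)
antidiagonal-difference a c b j zero    =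
  solve 3 (λ a c b → a :* (c :+ :- b) := a :* c :+ :- (a :* b)) refl (a j) c (b 0)
  where open ℚ[i]-Solver
antidiagonal-difference a c b j (suc l) = trans
  (cong (a j ⊗ (c ⊕ (⊖ b (suc l))) ⊕_) (antidiagonal-difference a c b (suc j) l))
  (solve 5 (λ a c b u v → a :* (c :+ :- b) :+ (u :+ :- v) := (a :* c :+ u) :+ :- (a :* b :+ v)) refl
    (a j) c (b (suc l)) (antidiagonal (λ i _ → a i ⊗ c) (suc j) l) (antidiagonal (λ i k → a i ⊗ b k) (suc j) l))
  where open ℚ[i]-Solver

ι[i] : ℕ → ℚ[i]
ι[i] k = ℚ[i].real (ι k)

ι[i]-suc : ∀ k → ι[i] (suc k) ≡ 1ℚ[i] ⊕ ι[i] k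
ι[i]-suc k = cong ℚ[i].real (ι-suc k)

ι[i]-+ : ∀ l j → ι[i] (suc (l ℕ.+ j)) ≡ ι[i] (suc l) ⊕ ι[i] j
ι[i]-+ zero    j = ι[i]-suc j
ι[i]-+ (suc l) j = trans (ι[i]-suc (suc (l ℕ.+ j))) (trans (cong (1ℚ[i] ⊕_) (ι[i]-+ l j))
  (trans (sym (Q.+-assoc 1ℚ[i] (ι[i] (suc l)) (ι[i] j))) (cong (_⊕ ι[i] j) (sym (ι[i]-suc (suc l))))))

recip⊗ι : ∀ k → ℚ[i].real (recip k) ⊗ ℚ[i].real (ι (suc k)) ≡ 1ℚ[i]
recip⊗ι k = cong₂ _+i_
  (trans (solve 2 (λ r i → r :* i :+ :- (con 0ℚ :* con 0ℚ) := r :* i) refl (recip k) (ι (suc k))) (recip-ι k))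
  (solve 2 (λ r i → r :* con 0ℚ :+ con 0ℚ :* i := con 0ℚ) refl (recip k) (ι (suc k)))
  where open ℚSolver.+-*-Solver

-- The division-free recursion for vᵏ/k!. Through it the Cauchy product is computed without binomial
-- coefficients.
scaled-expTerm : ∀ k v → ι[i] (suc k) ⊗ expTerm (suc k) v ≡ expTerm k v ⊗ v
scaled-expTerm k v = trans (cong (ι[i] (suc k) ⊗_) (trans (expTerm-suc k v) (scale (recip k) (expTerm k v ⊗ v))))
  (trans (solve 3 (λ c r x → c :* (r :* x) := (r :* c) :* x) refl
      (ι[i] (suc k)) (ℚ[i].real (recip k)) (expTerm k v ⊗ v))
    (trans (cong (_⊗ (expTerm k v ⊗ v)) (recip⊗ι k)) (Q.*-identityˡ (expTerm k v ⊗ v))))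
  where
  open ℚ[i]-Solver
  scale : ∀ r x → r · x ≡ ℚ[i].real r ⊗ x
  scale r (a +i b) = cong₂ _+i_
    (ℚS.solve 3 (λ r a b → r ℚS.:* a ℚS.:= r ℚS.:* a ℚS.:+ ℚS.:- (ℚS.con 0ℚ ℚS.:* b)) refl r a b)
    (ℚS.solve 3 (λ r a b → r ℚS.:* b ℚS.:= r ℚS.:* b ℚS.:+ ℚS.con 0ℚ ℚS.:* a) refl r a b)
    where module ℚS = ℚSolver.+-*-Solver

ι[i]-cancel : ∀ k x y → ι[i] (suc k) ⊗ x ≡ ι[i] (suc k) ⊗ y → x ≡ y
ι[i]-cancel k x y eq = trans (expand x) (trans (cong (ℚ[i].real (recip k) ⊗_) eq) (sym (expand y)))
  where
  expand : ∀ x → x ≡ ℚ[i].real (recip k) ⊗ (ι[i] (suc k) ⊗ x)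
  expand x = trans (sym (Q.*-identityˡ x)) (trans (cong (_⊗ x) (sym (recip⊗ι k)))
    (Q.*-assoc (ℚ[i].real (recip k)) (ι[i] (suc k)) x))

module _ (z w : ℚ[i]) where

  private
    t u : ℕ → ℚ[i]
    t k = expTerm k z
    u k = expTerm k w

    d : ℕ → ℕ → ℚ[i]
    d = antidiagonal (λ i k → t i ⊗ u k)

    -- This is `d j (l − 1)`, with the empty sum 0 at l = 0, so that the head splits off every
    -- antidiagonal in the same way.
    d⁻ : ℕ → ℕ → ℚ[i]
    d⁻ j zero    = 0ℚ[i]
    d⁻ j (suc l) = d j l

  d-head : ∀ j l → d j l ≡ t j ⊗ u l ⊕ d⁻ (suc j) l
  d-head j zero    = sym (Q.+-identityʳ (t j ⊗ u 0))
  d-head j (suc l) = refl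

  -- (i + k) zⁱ wᵏ / i! k! = z zⁱ⁻¹ wᵏ / (i−1)! k! + w zⁱ wᵏ⁻¹ / i! (k−1)!, summed along an antidiagonal.
  d-recurrence : ∀ j l → ι[i] (suc (l ℕ.+ j)) ⊗ d (suc j) l ≡ z ⊗ d j l ⊕ w ⊗ d⁻ (suc j) l
  d-recurrence j zero    = begin
    ι[i] (suc j) ⊗ (t (suc j) ⊗ u 0)    ≡⟨ solve 3 (λ c t u → c :* (t :* u) := (c :* t) :* u) refl
                                         (ι[i] (suc j)) (t (suc j)) (u 0) ⟩
    (ι[i] (suc j) ⊗ t (suc j)) ⊗ u 0    ≡⟨ cong (_⊗ u 0) (scaled-expTerm j z) ⟩
    (t j ⊗ z) ⊗ u 0                  ≡⟨ solve 4 (λ t z u w → (t :* z) :* u := z :* (t :* u) :+ w :* con 0ℚ[i]) refl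
                                         (t j) z (u 0) w ⟩
    z ⊗ d j 0 ⊕ w ⊗ 0ℚ[i]            ∎
    where
    open ℚ[i]-Solver
    open ≡-Reasoning
  d-recurrence j (suc l) = begin
    ι[i] (suc (suc l ℕ.+ j)) ⊗ (t (suc j) ⊗ u (suc l) ⊕ d (suc (suc j)) l)
      ≡⟨ Q.distribˡ (ι[i] (suc (suc l ℕ.+ j))) (t (suc j) ⊗ u (suc l)) (d (suc (suc j)) l) ⟩
    ι[i] (suc (suc l ℕ.+ j)) ⊗ (t (suc j) ⊗ u (suc l)) ⊕ ι[i] (suc (suc l ℕ.+ j)) ⊗ d (suc (suc j)) l
      ≡⟨ cong₂ _⊕_
           (cong (_⊗ (t (suc j) ⊗ u (suc l))) (trans (cong (ι[i] ∘ suc) (sym (ℕ.+-suc l j))) (ι[i]-+ l (suc j))))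
           (trans (cong (λ k → ι[i] (suc k) ⊗ d (suc (suc j)) l) (sym (ℕ.+-suc l j))) (d-recurrence (suc j) l)) ⟩
    (ι[i] (suc l) ⊕ ι[i] (suc j)) ⊗ (t (suc j) ⊗ u (suc l)) ⊕ (z ⊗ d (suc j) l ⊕ w ⊗ e)
      ≡⟨ solve 8 (λ a b t u z w x e →
           (a :+ b) :* (t :* u) :+ (z :* x :+ w :* e) :=
           ((b :* t) :* u :+ t :* (a :* u)) :+ (z :* x :+ w :* e))
           refl (ι[i] (suc l)) (ι[i] (suc j)) (t (suc j)) (u (suc l)) z w (d (suc j) l) e ⟩
    ((ι[i] (suc j) ⊗ t (suc j)) ⊗ u (suc l) ⊕ t (suc j) ⊗ (ι[i] (suc l) ⊗ u (suc l))) ⊕ (z ⊗ d (suc j) l ⊕ w ⊗ e)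
      ≡⟨ cong (_⊕ (z ⊗ d (suc j) l ⊕ w ⊗ e)) (cong₂ _⊕_
           (cong (_⊗ u (suc l)) (scaled-expTerm j z)) (cong (t (suc j) ⊗_) (scaled-expTerm l w))) ⟩
    ((t j ⊗ z) ⊗ u (suc l) ⊕ t (suc j) ⊗ (u l ⊗ w)) ⊕ (z ⊗ d (suc j) l ⊕ w ⊗ e)
      ≡⟨ solve 8 (λ a b t u z w x e →
           ((a :* z) :* u :+ t :* (b :* w)) :+ (z :* x :+ w :* e) :=
           z :* (a :* u :+ x) :+ w :* (t :* b :+ e))
           refl (t j) (u l) (t (suc j)) (u (suc l)) z w (d (suc j) l) e ⟩
    z ⊗ d j (suc l) ⊕ w ⊗ (t (suc j) ⊗ u l ⊕ e)
      ≡⟨ cong (λ x → z ⊗ d j (suc l) ⊕ w ⊗ x) (sym (d-head (suc j) l)) ⟩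
    z ⊗ d j (suc l) ⊕ w ⊗ d (suc j) l ∎
    where
    open ℚ[i]-Solver
    open ≡-Reasoning
    e = d⁻ (suc (suc j)) l

  -- The binomial theorem by recursion: both sides satisfy (k + 1) x(k + 1) = x(k) (z + w). The term
  -- i = 0 has no factor z to lower, so it is split off; lowering its power of w instead gives the
  -- head that completes `d⁻ 1 k` to `d 0 k`.
  d≡expTerm : ∀ k → d 0 k ≡ expTerm k (z ⊕ w)
  d≡expTerm zero    = refl
  d≡expTerm (suc k) = ι[i]-cancel k _ _ (begin
    ι[i] (suc k) ⊗ (t 0 ⊗ u (suc k) ⊕ d 1 k)
      ≡⟨ solve 4 (λ c t u x → c :* (t :* u :+ x) := t :* (c :* u) :+ c :* x) refl
           (ι[i] (suc k)) (t 0) (u (suc k)) (d 1 k) ⟩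
    t 0 ⊗ (ι[i] (suc k) ⊗ u (suc k)) ⊕ ι[i] (suc k) ⊗ d 1 k
      ≡⟨ cong₂ _⊕_ (cong (t 0 ⊗_) (scaled-expTerm k w))
           (trans (cong (λ m → ι[i] (suc m) ⊗ d 1 k) (sym (ℕ.+-identityʳ k))) (d-recurrence 0 k)) ⟩
    t 0 ⊗ (u k ⊗ w) ⊕ (z ⊗ d 0 k ⊕ w ⊗ d⁻ 1 k)
      ≡⟨ solve 6 (λ t u z w x e → t :* (u :* w) :+ (z :* x :+ w :* e) := z :* x :+ (t :* u :+ e) :* w)
           refl (t 0) (u k) z w (d 0 k) (d⁻ 1 k) ⟩
    z ⊗ d 0 k ⊕ (t 0 ⊗ u k ⊕ d⁻ 1 k) ⊗ w
      ≡⟨ cong (λ x → z ⊗ d 0 k ⊕ x ⊗ w) (sym (d-head 0 k)) ⟩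
    z ⊗ d 0 k ⊕ d 0 k ⊗ w
      ≡⟨ solve 3 (λ z w x → z :* x :+ x :* w := x :* (z :+ w)) refl z w (d 0 k) ⟩
    d 0 k ⊗ (z ⊕ w)
      ≡⟨ cong (_⊗ (z ⊕ w)) (d≡expTerm k) ⟩
    expTerm k (z ⊕ w) ⊗ (z ⊕ w)
      ≡⟨ scaled-expTerm k (z ⊕ w) ⟨
    ι[i] (suc k) ⊗ expTerm (suc k) (z ⊕ w) ∎)
    where
    open ℚ[i]-Solver
    open ≡-Reasoning

  -- Row i carries the powers of w up to degree n - i, so `triangle 0 n` collects the products
  -- `t i ⊗ u k` with i + k ≤ n.
  triangle : ℕ → ℕ → ℚ[i]
  triangle = antidiagonal (λ i k → t i ⊗ expSum k w)

  -- Each row gains one term and one new row opens; together these form an antidiagonal.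
  triangle-suc : ∀ j l → triangle j (suc l) ≡ triangle j l ⊕ d j (suc l)
  triangle-suc j zero    =
    solve 4 (λ a b x y → a :* (x :+ y) :+ b :* x := a :* x :+ (a :* y :+ b :* x)) refl
      (t j) (t (suc j)) (u 0) (u 1)
    where open ℚ[i]-Solver
  triangle-suc j (suc l) = trans (cong (t j ⊗ (expSum (suc l) w ⊕ u (suc (suc l))) ⊕_) (triangle-suc (suc j) l))
    (solve 5 (λ a x y p q → a :* (x :+ y) :+ (p :+ q) := (a :* x :+ p) :+ (a :* y :+ q)) refl
      (t j) (expSum (suc l) w) (u (suc (suc l))) (triangle (suc j) l) (d (suc j) (suc l)))
    where open ℚ[i]-Solver

  triangle≡expSum : ∀ n → triangle 0 n ≡ expSum n (z ⊕ w)
  triangle≡expSum zero    = refl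
  triangle≡expSum (suc n) = trans (triangle-suc 0 n) (cong₂ _⊕_ (triangle≡expSum n) (d≡expTerm (suc n)))

-- Uniform error estimate for the product rule

pow₂ : ℕ → ℚ
pow₂ zero    = 1ℚ
pow₂ (suc n) = pow₂ n ℚ.+ pow₂ n

pow₂-+ : ∀ m n → pow₂ (m ℕ.+ n) ≡ pow₂ m ℚ.* pow₂ n
pow₂-+ zero    n = sym (ℚ.*-identityˡ (pow₂ n))
pow₂-+ (suc m) n = trans (cong (λ p → p ℚ.+ p) (pow₂-+ m n)) (sym (ℚ.*-distribʳ-+ (pow₂ n) (pow₂ m) (pow₂ m)))

-- Trades the geometric gain 2⁻ⁿ for the rate `recip n`, whose smallness is given by `recip-<ε`.
ι<pow₂ : ∀ n → ι (suc n) ℚ.≤ pow₂ n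
ι<pow₂ zero    = ℚ.≤-refl
ι<pow₂ (suc n) = begin
  ι (suc (suc n))         ≡⟨ ι-suc (suc n) ⟩
  1ℚ ℚ.+ ι (suc n)        ≤⟨ ℚ.+-mono-≤ (ℚ.≤-trans (ι-mono-≤ {1} {suc n} (ℕ.s≤s ℕ.z≤n)) (ι<pow₂ n)) (ι<pow₂ n) ⟩
  pow₂ n ℚ.+ pow₂ n       ∎
  where open ℚ.≤-Reasoning

pow₂-nonNeg : ∀ n → 0ℚ ℚ.≤ pow₂ n
pow₂-nonNeg zero    = ℚ.<⇒≤ (ℚ.positive⁻¹ 1ℚ)
pow₂-nonNeg (suc n) = 0≤+ (pow₂-nonNeg n) (pow₂-nonNeg n)

pow₂-≤ : ∀ m n → pow₂ n ℚ.≤ pow₂ (m ℕ.+ n)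
pow₂-≤ zero    n = ℚ.≤-refl
pow₂-≤ (suc m) n = ℚ.≤-trans (pow₂-≤ m n) (subst (ℚ._≤ pow₂ (m ℕ.+ n) ℚ.+ pow₂ (m ℕ.+ n))
  (ℚ.+-identityʳ (pow₂ (m ℕ.+ n))) (ℚ.+-monoʳ-≤ (pow₂ (m ℕ.+ n)) (pow₂-nonNeg (m ℕ.+ n))))

-- The terms of e^z e^w missing from the partial sum of e^(z + w) have degree
-- exceeding n, so doubling the radius of the majorant gains a factor 2⁻ⁿ.
module _ (B : ℚ) (0≤B : 0ℚ ℚ.≤ B) where

  open Majorant (B ℚ.+ B) (0≤+ 0≤B 0≤B)

  -- Here `s k` is (2B)ᵏ/k!, so the doubled radius absorbs one factor 2 per degree.
  expTerm-bound : ∀ k z → ‖ z ‖ ℚ.≤ B → pow₂ k ℚ.* ‖ expTerm k z ‖ ℚ.≤ s k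
  expTerm-bound zero    z _ = ℚ.≤-refl
  expTerm-bound (suc k) z h = begin
    pow₂ (suc k) * ‖ expTerm (suc k) z ‖          ≡⟨ cong (λ v → pow₂ (suc k) * ‖ v ‖) (expTerm-suc k z) ⟩
    pow₂ (suc k) * ‖ recip k · (t ⊗ z) ‖          ≡⟨ cong (pow₂ (suc k) *_) (‖·‖ (t ⊗ z) (recip-nonNeg k)) ⟩
    pow₂ (suc k) * (recip k * ‖ t ⊗ z ‖)          ≤⟨ *ˡ (pow₂-nonNeg (suc k)) (*ˡ (recip-nonNeg k)
      (ℚ.≤-trans (‖⊗‖ t z) (*ˡ (‖‖-nonNeg t) h))) ⟩
    pow₂ (suc k) * (recip k * (‖ t ‖ * B))        ≡⟨ solve 4 (λ p r x b →
      (p :+ p) :* (r :* (x :* b)) := r :* ((p :* x) :* (b :+ b))) refl (pow₂ k) (recip k) ‖ t ‖ B ⟩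
    recip k * ((pow₂ k * ‖ t ‖) * (B + B))        ≤⟨ *ˡ (recip-nonNeg k)
      (ℚ.*-monoʳ-≤-nonNeg (B + B) {{nonNegative (0≤+ 0≤B 0≤B)}} (expTerm-bound k z h)) ⟩
    recip k * (s k * (B + B))                     ∎
    where
    open import Data.Rational.Base
    open ℚSolver.+-*-Solver
    open ℚ.≤-Reasoning
    t = expTerm k z
    *ˡ : ∀ {p q r} → 0ℚ ≤ r → p ≤ q → r * p ≤ r * q
    *ˡ {r = r} 0≤r = ℚ.*-monoˡ-≤-nonNeg r {{nonNegative 0≤r}}

  S-nonNeg : ∀ n → 0ℚ ℚ.≤ S n
  S-nonNeg zero    = ℚ.≤-refl
  S-nonNeg (suc n) = 0≤+ (S-nonNeg n) (s-nonNeg n)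

  -- A tail term has degree m > l, so 2ˡ ≤ 2ᵐ and `expTerm-bound` applies to it. The whole of `S`
  -- may serve as the bound because the gain sits in the factor 2ˡ.
  expSum-tail : ∀ i l w → ‖ w ‖ ℚ.≤ B →
    pow₂ l ℚ.* ‖ expSum (i ℕ.+ l) w ⊕ (⊖ expSum l w) ‖ ℚ.≤ S (suc (i ℕ.+ l))
  expSum-tail zero    l w h = begin
    pow₂ l * ‖ expSum l w ⊕ (⊖ expSum l w) ‖   ≡⟨ cong (λ v → pow₂ l * ‖ v ‖) {x = expSum l w ⊕ (⊖ expSum l w)} {y = 0ℚ[i]}
      (Q.-‿inverseʳ (expSum l w)) ⟩
    pow₂ l * 0ℚ                                ≡⟨ ℚ.*-zeroʳ (pow₂ l) ⟩
    0ℚ                                         ≤⟨ S-nonNeg (suc l) ⟩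
    S (suc l)                                  ∎
    where
    open import Data.Rational.Base
    open ℚ.≤-Reasoning
  expSum-tail (suc i) l w h = begin
    pow₂ l * ‖ (e ⊕ t) ⊕ (⊖ e′) ‖                     ≡⟨ cong (λ v → pow₂ l * ‖ v ‖)
      (solve 3 (λ e t e′ → (e :+ t) :+ :- e′ := (e :+ :- e′) :+ t) refl e t e′) ⟩
    pow₂ l * ‖ (e ⊕ (⊖ e′)) ⊕ t ‖                     ≤⟨ ℚ.*-monoˡ-≤-nonNeg (pow₂ l)
      {{nonNegative (pow₂-nonNeg l)}} (‖⊕‖ (e ⊕ (⊖ e′)) t) ⟩
    pow₂ l * (‖ e ⊕ (⊖ e′) ‖ + ‖ t ‖)                 ≡⟨ ℚ.*-distribˡ-+ (pow₂ l) ‖ e ⊕ (⊖ e′) ‖ ‖ t ‖ ⟩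
    pow₂ l * ‖ e ⊕ (⊖ e′) ‖ + pow₂ l * ‖ t ‖          ≤⟨ ℚ.+-mono-≤ (expSum-tail i l w h)
      (ℚ.≤-trans (ℚ.*-monoʳ-≤-nonNeg ‖ t ‖ {{nonNegative (‖‖-nonNeg t)}} (pow₂-≤ (suc i) l))
        (expTerm-bound m w h)) ⟩
    S m + s m                                         ∎
    where
    open import Data.Rational.Base
    open ℚ[i]-Solver
    open ℚ.≤-Reasoning
    m  = suc (i ℕ.+ l)
    e  = expSum (i ℕ.+ l) w
    e′ = expSum l w
    t  = expTerm m w

  -- The bounds `s i` telescope: `S n` sums `s` below n, so the indices from j to l + j contribute
  -- `S (suc (l + j)) − S j`.
  antidiagonal-bound : ∀ N M (h : ℕ → ℕ → ℚ[i]) →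
    (∀ i k → k ℕ.+ i ≡ N → pow₂ N ℚ.* ‖ h i k ‖ ℚ.≤ s i ℚ.* M) →
    ∀ j l → l ℕ.+ j ≡ N → pow₂ N ℚ.* ‖ antidiagonal h j l ‖ ℚ.≤ (S (suc (l ℕ.+ j)) ℚ.- S j) ℚ.* M
  antidiagonal-bound N M h bound j zero    eq = ℚ.≤-trans (bound j 0 eq) (ℚ.≤-reflexive
    (solve 3 (λ a b m → b :* m := ((a :+ b) :- a) :* m) refl (S j) (s j) M))
    where open ℚSolver.+-*-Solver
  antidiagonal-bound N M h bound j (suc l) eq = begin
    pow₂ N * ‖ h j (suc l) ⊕ antidiagonal h (suc j) l ‖
      ≤⟨ ℚ.*-monoˡ-≤-nonNeg (pow₂ N) {{nonNegative (pow₂-nonNeg N)}}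
           (‖⊕‖ (h j (suc l)) (antidiagonal h (suc j) l)) ⟩
    pow₂ N * (‖ h j (suc l) ‖ + ‖ antidiagonal h (suc j) l ‖)
      ≡⟨ ℚ.*-distribˡ-+ (pow₂ N) ‖ h j (suc l) ‖ ‖ antidiagonal h (suc j) l ‖ ⟩
    pow₂ N * ‖ h j (suc l) ‖ + pow₂ N * ‖ antidiagonal h (suc j) l ‖
      ≤⟨ ℚ.+-mono-≤ (bound j (suc l) eq) (antidiagonal-bound N M h bound (suc j) l (trans (ℕ.+-suc l j) eq)) ⟩
    s j * M + (S (suc (l ℕ.+ suc j)) - (S j + s j)) * M
      ≡⟨ solve 4 (λ a b c m → b :* m :+ (c :- (a :+ b)) :* m := (c :- a) :* m) refl
           (S j) (s j) (S (suc (l ℕ.+ suc j))) M ⟩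
    (S (suc (l ℕ.+ suc j)) - S j) * M
      ≡⟨ cong (λ k → (S (suc k) - S j) * M) (ℕ.+-suc l j) ⟩
    (S (suc (suc l ℕ.+ j)) - S j) * M ∎
    where
    open import Data.Rational.Base
    open ℚSolver.+-*-Solver
    open ℚ.≤-Reasoning

  expSum-+-error : ∀ n z w → ‖ z ‖ ℚ.≤ B → ‖ w ‖ ℚ.≤ B →
    pow₂ n ℚ.* ‖ expSum n z ⊗ expSum n w ⊕ (⊖ expSum n (z ⊕ w)) ‖ ℚ.≤ S (suc n) ℚ.* S (suc n)
  expSum-+-error n z w hz hw = begin
    pow₂ n * ‖ expSum n z ⊗ expSum n w ⊕ (⊖ expSum n (z ⊕ w)) ‖   ≡⟨ cong (λ v → pow₂ n * ‖ v ‖)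
      (sym (trans (antidiagonal-difference (λ i → expTerm i z) (expSum n w) (λ k → expSum k w) 0 n)
        (cong₂ (λ u v → u ⊕ (⊖ v)) (antidiagonal-expTerm z (expSum n w) n) (triangle≡expSum z w n)))) ⟩
    pow₂ n * ‖ antidiagonal h 0 n ‖                               ≤⟨
      antidiagonal-bound n (S (suc n)) h bound 0 n (ℕ.+-identityʳ n) ⟩
    (S (suc (n ℕ.+ 0)) - 0ℚ) * S (suc n)                          ≡⟨ cong (_* S (suc n)) (trans
      (ℚ.+-identityʳ (S (suc (n ℕ.+ 0)))) (cong (S ∘ suc) (ℕ.+-identityʳ n))) ⟩
    S (suc n) * S (suc n)                                         ∎
    where
    open import Data.Rational.Base
    open ℚSolver.+-*-Solver
    open ℚ.≤-Reasoning
    h : ℕ → ℕ → ℚ[i]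
    h i k = expTerm i z ⊗ (expSum n w ⊕ (⊖ expSum k w))
    -- The weight 2ⁿ is shared out along the antidiagonal: 2ⁱ is absorbed by the i-th term at z, 2ᵏ
    -- by the tail at w beyond degree k.
    split : ∀ i k → k ℕ.+ i ≡ n → pow₂ n ≡ pow₂ i * pow₂ k
    split i k eq = trans (cong pow₂ (sym eq)) (trans (pow₂-+ k i) (ℚ.*-comm (pow₂ k) (pow₂ i)))
    bound : ∀ i k → k ℕ.+ i ≡ n → pow₂ n * ‖ h i k ‖ ≤ s i * S (suc n)
    bound i k eq = begin
      pow₂ n * ‖ h i k ‖                             ≤⟨ ℚ.*-monoˡ-≤-nonNeg (pow₂ n) {{nonNegative (pow₂-nonNeg n)}}
                                                          (‖⊗‖ (expTerm i z) r) ⟩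
      pow₂ n * (‖ expTerm i z ‖ * ‖ r ‖)             ≡⟨ cong (_* (‖ expTerm i z ‖ * ‖ r ‖)) (split i k eq) ⟩
      (pow₂ i * pow₂ k) * (‖ expTerm i z ‖ * ‖ r ‖)  ≡⟨ solve 4 (λ a b c d →
        (a :* b) :* (c :* d) := (a :* c) :* (b :* d)) refl (pow₂ i) (pow₂ k) ‖ expTerm i z ‖ ‖ r ‖ ⟩
      (pow₂ i * ‖ expTerm i z ‖) * (pow₂ k * ‖ r ‖)  ≤⟨ *-mono-≤ (0≤* (pow₂-nonNeg i) (‖‖-nonNeg (expTerm i z)))
        (S-nonNeg (suc n)) (expTerm-bound i z hz) (subst (λ m → pow₂ k * ‖ expSum m w ⊕ (⊖ expSum k w) ‖ ≤ S (suc m))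
          (trans (ℕ.+-comm i k) eq) (expSum-tail i k w hw)) ⟩
      s i * S (suc n)                                ∎
      where r = expSum n w ⊕ (⊖ expSum k w)

  -- The arguments may move with n inside the ball of radius B, as they do in the diagonal sequence
  -- defining `exp`.
  expSum-+-limit : ∀ (z w : ℕ → ℚ[i]) N → (∀ n → N ℕ.≤ n → ‖ z n ‖ ℚ.≤ B) → (∀ n → N ℕ.≤ n → ‖ w n ‖ ℚ.≤ B) →
    ∀ ε → 0ℚ ℚ.< ε → ∃ λ N → ∀ n → N ℕ.≤ n →
    ‖ expSum n (z n) ⊗ expSum n (w n) ⊕ (⊖ expSum n (z n ⊕ w n)) ‖ ℚ.< ε
  -- The majorant already has radius B + B, and `Tail` asks for K to dominate twice its radius.
  expSum-+-limit z w N hz hw ε 0<ε = from-K (archimedean ((B + B) + (B + B)))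
    where
    open import Data.Rational.Base
    open ℚ.≤-Reasoning
    x : ℕ → ℚ[i]
    x n = expSum n (z n) ⊗ expSum n (w n) ⊕ (⊖ expSum n (z n ⊕ w n))
    Goal : Set
    Goal = ∃ λ N → ∀ n → N ℕ.≤ n → ‖ x n ‖ < ε
    from-K : (∃ λ K → (B + B) + (B + B) ≤ ι K) → Goal
    from-K (K , 2B≤K) = from-L (recip-<ε {M * M} 0<ε)
      where
      open Tail K 2B≤K
      M = U K
      0≤M : 0ℚ ≤ M
      0≤M = ℚ.≤-trans (S-nonNeg K) (S≤U K)
      from-L : (∃ λ L → ∀ n → L ℕ.≤ n → recip n * (M * M) < ε) → Goal
      from-L (L , small) = K ℕ.+ (L ℕ.+ N) , λ n le → begin-strict
        ‖ x n ‖                              ≡⟨ ℚ.*-identityˡ ‖ x n ‖ ⟨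
        1ℚ * ‖ x n ‖                         ≡⟨ cong (_* ‖ x n ‖) (sym (recip-ι n)) ⟩
        (recip n * ι (suc n)) * ‖ x n ‖      ≡⟨ ℚ.*-assoc (recip n) (ι (suc n)) ‖ x n ‖ ⟩
        recip n * (ι (suc n) * ‖ x n ‖)      ≤⟨ ℚ.*-monoˡ-≤-nonNeg (recip n) {{nonNegative (recip-nonNeg n)}}
          (ℚ.≤-trans (ℚ.*-monoʳ-≤-nonNeg ‖ x n ‖ {{nonNegative (‖‖-nonNeg (x n))}} (ι<pow₂ n))
          (ℚ.≤-trans (expSum-+-error n (z n) (w n) (hz n (N≤ le)) (hw n (N≤ le)))
            (*-mono-≤ (S-nonNeg (suc n)) 0≤M (S-bound (suc n) (K≤ le)) (S-bound (suc n) (K≤ le))))) ⟩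
        recip n * (M * M)                    <⟨ small n (ℕ.m+n≤o⇒m≤o L (ℕ.m+n≤o⇒n≤o K le)) ⟩
        ε                                    ∎
        where
        N≤ : ∀ {n} → K ℕ.+ (L ℕ.+ N) ℕ.≤ n → N ℕ.≤ n
        N≤ le = ℕ.m+n≤o⇒n≤o L (ℕ.m+n≤o⇒n≤o K le)
        K≤ : ∀ {n} → K ℕ.+ (L ℕ.+ N) ℕ.≤ n → K ℕ.≤ suc n
        K≤ le = ℕ.m≤n⇒m≤1+n (ℕ.m+n≤o⇒m≤o K le)

exp-+ : ∀ z w → exp z *ᶜ exp w ≃ exp (z +ᶜ w)
exp-+ z w = ≃-limit {exp z *ᶜ exp w} {exp (z +ᶜ w)} (from-bounds (approx-bounded z) (approx-bounded w))
  where
  from-bounds : (∃ λ N → ∃ λ B → 0ℚ ℚ.< B × (∀ n → N ℕ.≤ n → ‖ approx z n ‖ ℚ.≤ B)) →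
                (∃ λ N → ∃ λ B → 0ℚ ℚ.< B × (∀ n → N ℕ.≤ n → ‖ approx w n ‖ ℚ.≤ B)) →
                ∀ ε → 0ℚ ℚ.< ε → ∃ λ N → ∀ n → N ℕ.≤ n →
                ‖ approx (exp z *ᶜ exp w) n ⊕ (⊖ approx (exp (z +ᶜ w)) n) ‖ ℚ.< ε
  from-bounds (N , B , 0<B , hz) (N′ , B′ , 0<B′ , hw) =
    expSum-+-limit (B ℚ.+ B′) (0≤+ (ℚ.<⇒≤ 0<B) (ℚ.<⇒≤ 0<B′)) (approx z) (approx w) (N ℕ.+ N′)
      (λ n le → ℚ.≤-trans (hz n (ℕ.m+n≤o⇒m≤o N le))
        (subst (ℚ._≤ B ℚ.+ B′) (ℚ.+-identityʳ B) (ℚ.+-monoʳ-≤ B (ℚ.<⇒≤ 0<B′))))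
      (λ n le → ℚ.≤-trans (hw n (ℕ.m+n≤o⇒n≤o N le))
        (subst (ℚ._≤ B ℚ.+ B′) (ℚ.+-identityˡ B′) (ℚ.+-monoˡ-≤ B′ (ℚ.<⇒≤ 0<B))))

-- Conjugation and phases

conj-⊗ : ∀ z w → ℚ[i].conj (z ⊗ w) ≡ ℚ[i].conj z ⊗ ℚ[i].conj w
conj-⊗ (a +i b) (c +i d) = cong₂ _+i_
  (solve 4 (λ a b c d → a :* c :+ :- (b :* d) := a :* c :+ :- (:- b :* :- d)) refl a b c d)
  (solve 4 (λ a b c d → :- (a :* d :+ b :* c) := a :* :- d :+ :- b :* c) refl a b c d)
  where open ℚSolver.+-*-Solver

conj-⊕ : ∀ z w → ℚ[i].conj (z ⊕ w) ≡ ℚ[i].conj z ⊕ ℚ[i].conj w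
conj-⊕ z w = cong (re z ℚ.+ re w +i_) (ℚ.neg-distrib-+ (im z) (im w))

conj-^ : ∀ z k → ℚ[i].conj (z ℚ[i].^ k) ≡ ℚ[i].conj z ℚ[i].^ k
conj-^ z zero    = refl
conj-^ z (suc k) = trans (conj-⊗ z (z ℚ[i].^ k)) (cong (ℚ[i].conj z ⊗_) (conj-^ z k))

conj-expTerm : ∀ k z → ℚ[i].conj (expTerm k z) ≡ expTerm k (ℚ[i].conj z)
conj-expTerm k z = trans (conj-⊗ c (z ℚ[i].^ k)) (cong (c ⊗_) (conj-^ z k))
  where c = ℚ[i].real ((+ 1 ℚ./ (k !)) {{k !≢0}})

conj-expSum : ∀ n z → ℚ[i].conj (expSum n z) ≡ expSum n (ℚ[i].conj z)
conj-expSum zero    z = conj-expTerm 0 z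
conj-expSum (suc n) z = trans (conj-⊕ (expSum n z) (expTerm (suc n) z))
  (cong₂ _⊕_ (conj-expSum n z) (conj-expTerm (suc n) z))

expSum-0 : ∀ n → expSum n 0ℚ[i] ≡ 1ℚ[i]
expSum-0 zero    = refl
expSum-0 (suc n) = trans (cong₂ _⊕_ (expSum-0 n) term≡0) (Q.+-identityʳ 1ℚ[i])
  where
  term≡0 : expTerm (suc n) 0ℚ[i] ≡ 0ℚ[i]
  term≡0 = trans (expTerm-suc n 0ℚ[i]) (trans (cong (recip n ·_) (Q.zeroʳ (expTerm n 0ℚ[i])))
    (cong₂ _+i_ (ℚ.*-zeroʳ (recip n)) (ℚ.*-zeroʳ (recip n))))

conj-cong : ∀ {z w} → z ≃ w → ℂ.conj z ≃ ℂ.conj w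
conj-cong {z} {w} (wrap (p , q)) = wrap (p , -ʳ-cong {im z} {im w} q)

conj-* : ∀ z w → ℂ.conj (z *ᶜ w) ≃ ℂ.conj z *ᶜ ℂ.conj w
conj-* z w = ≃-pointwise (λ n → conj-⊗ (approx z n) (approx w n))

-- The partial sums have rational coefficients, so conjugation passes to the argument, and the
-- conjugate of iα is i(-α).
conj-cis : ∀ α → ℂ.conj (cis α) ≃ cis (-ʳ α)
conj-cis α = ≃-pointwise (λ n → conj-expSum n (approx (ℂ.imaginary α) n))

cis-0 : cis 0ℝ ≃ 1ℂ
cis-0 = ≃-pointwise expSum-0

-- γ is any real that agrees with α + β term by term, so that π/4 + π/4 can be read directly as π/2,
-- and -α + α as 0.
cis-+ : ∀ α β γ → (∀ n → seq α n ℚ.+ seq β n ≡ seq γ n) → cis α *ᶜ cis β ≃ cis γ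
cis-+ α β γ eq = C.trans (exp-+ (ℂ.imaginary α) (ℂ.imaginary β))
  (≃-pointwise (λ n → cong (λ y → expSum n (0ℚ +i y)) (eq n)))

conj-cis-* : ∀ α → ℂ.conj (cis α) *ᶜ cis α ≃ 1ℂ
conj-cis-* α = C.trans (C.*-congʳ {cis α} (conj-cis α))
  (C.trans (cis-+ (-ʳ α) α 0ℝ (λ n → ℚ.+-inverseˡ (seq α n))) cis-0)

-- cis (π/2) is purely imaginary of modulus 1, hence w² = −w̄ w = −1.
ζ⁴≃-1 : ∀ {π} → IsPi π → ζ π ^ 4 ≃ -ᶜ 1ℂ
ζ⁴≃-1 {π} isPi = begin
  z ^ 4                  ≈⟨ ≃-pointwise (λ n → solve 1 (λ z →
                                  z :* (z :* (z :* (z :* con 1ℚ[i]))) := (z :* z) :* (z :* z)) refl (approx z n)) ⟩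
  (z *ᶜ z) *ᶜ (z *ᶜ z)   ≈⟨ C.*-cong z²≃w z²≃w ⟩
  w *ᶜ w                 ≈⟨ ≃-pointwise (λ n → solve 1 (λ w → w :* w := :- (:- w :* w)) refl (approx w n)) ⟩
  -ᶜ ((-ᶜ w) *ᶜ w)       ≈⟨ C.-‿cong (C.*-congʳ {w} conj-w) ⟨
  -ᶜ (ℂ.conj w *ᶜ w)     ≈⟨ C.-‿cong (conj-cis-* (fromℚ ½ *ʳ π)) ⟩
  -ᶜ 1ℂ                  ∎
  where
  open import Relation.Binary.Reasoning.Setoid C.setoid
  open ℚ[i]-Solver
  α = fromℚ (+ 1 ℚ./ 4) *ʳ π
  z = ζ π
  w = cis (fromℚ ½ *ʳ π)
  re≈0 : re w ≈ʳ 0ℝ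
  re≈0 = IsPi.cos[π/2] isPi
  z²≃w : z *ᶜ z ≃ w
  z²≃w = cis-+ α α (fromℚ ½ *ʳ π) (λ n → sym (ℚ.*-distribʳ-+ (seq π n) (+ 1 ℚ./ 4) (+ 1 ℚ./ 4)))
  conj-w : ℂ.conj w ≃ -ᶜ w
  conj-w = wrap
    ( ≈ʳ-trans {re w} {0ℝ} { -ʳ re w} re≈0 (≈ʳ-sym { -ʳ re w} {0ℝ} (-ʳ-cong {re w} {0ℝ} re≈0))
    , ≈ʳ-pointwise { -ʳ im w} { -ʳ im w} (λ _ → refl))

-- The square root

-- With r = 1/(m + 1), the integer square root gives q² ≤ n ≤ (q + r)², hence an error of at most r
-- (2q + r).
√-square : ∀ n → √ n *ʳ √ n ≈ʳ fromℚ (ι n)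
√-square n ε 0<ε = proj₁ small , λ m le → ℚ.≤-<-trans (error m) (proj₂ small m le)
  where
  open import Data.Rational.Base
  open ℚSolver.+-*-Solver
  open ℚ.≤-Reasoning
  open Sqrt-Lemmas
  a : ℕ → ℕ
  a m = isqrt (n ℕ.* (suc m ℕ.* suc m))
  q : ℕ → ℚ
  q = √-seq n
  -- Bounds 2 `q m` + `recip m` uniformly in m: `√-seq-≤` against index 0 gives `q m` ≤ `q 0` + 1,
  -- as `recip 0` is 1.
  C = (q 0 + 1ℚ) + (q 0 + 1ℚ) + 1ℚ
  small = recip-<ε {C} 0<ε
  q-nonNeg : ∀ m → 0ℚ ≤ q m
  q-nonNeg m = fromℚᵘ-mono-≤ {mkℚᵘ (+ 0) 0} {mkℚᵘ (+ a m) m}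
    (ℚᵘ.*≤* (ℤ.*-monoʳ-≤-nonNeg (+ 1) (ℤ.+≤+ (ℕ.z≤n {a m}))))
  numerator : ∀ b → + (b ℕ.* b) ≡ + b ℤ.* + b ℤ.* + 1
  numerator b = trans (ℤ.pos-* b b) (sym (ℤ.*-identityʳ (+ b ℤ.* + b)))
  lower : ∀ m → q m * q m ≤ ι n
  lower m = ℚ.≤-trans (ℚ.≤-reflexive (sym (fromℚᵘ-homo-* (mkℚᵘ (+ a m) m) (mkℚᵘ (+ a m) m))))
    (fromℚᵘ-mono-≤ {mkℚᵘ (+ a m) m ℚᵘ.* mkℚᵘ (+ a m) m} {mkℚᵘ (+ n) 0} (ℚᵘ.*≤*
      (subst₂ ℤ._≤_ (numerator (a m)) (ℤ.pos-* n (suc m ℕ.* suc m))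
        (ℤ.+≤+ (isqrt-lower (n ℕ.* (suc m ℕ.* suc m)))))))
  upper : ∀ m → ι n ≤ (q m + recip m) * (q m + recip m)
  upper m = subst (λ x → ι n ≤ x * x) (/-suc (a m) m) (ℚ.≤-trans
    (fromℚᵘ-mono-≤ {mkℚᵘ (+ n) 0} {mkℚᵘ (+ suc (a m)) m ℚᵘ.* mkℚᵘ (+ suc (a m)) m} (ℚᵘ.*≤*
      (subst₂ ℤ._≤_ (ℤ.pos-* n (suc m ℕ.* suc m)) (numerator (suc (a m)))
        (ℤ.+≤+ (ℕ.<⇒≤ (isqrt-upper (n ℕ.* (suc m ℕ.* suc m))))))))
    (ℚ.≤-reflexive (fromℚᵘ-homo-* (mkℚᵘ (+ suc (a m)) m) (mkℚᵘ (+ suc (a m)) m))))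
  recip≤1 : ∀ m → recip m ≤ 1ℚ
  recip≤1 m = fromℚᵘ-mono-≤ {mkℚᵘ (+ 1) m} {mkℚᵘ (+ 1) 0} (ℚᵘ.*≤* (ℤ.*-monoˡ-≤-nonNeg (+ 1) (ℤ.+≤+ (ℕ.s≤s ℕ.z≤n))))
  error : ∀ m → ∣ q m * q m - ι n ∣ ≤ recip m * C
  error m = ∣∣≤
    (begin
      q m * q m - ι n    ≤⟨ ℚ.+-monoˡ-≤ (- ι n) (lower m) ⟩
      ι n - ι n          ≡⟨ ℚ.+-inverseʳ (ι n) ⟩
      0ℚ                 ≤⟨ 0≤* (recip-nonNeg m) (0≤+ (0≤+ 0≤q₀+1 0≤q₀+1) 0≤1) ⟩
      recip m * C        ∎)
    (begin
      - (q m * q m - ι n)                                    ≡⟨ solve 2 (λ x i → :- (x :- i) := i :- x) refl (q m * q m) (ι n) ⟩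
      ι n - q m * q m                                        ≤⟨ ℚ.+-monoˡ-≤ (- (q m * q m)) (upper m) ⟩
      (q m + recip m) * (q m + recip m) - q m * q m          ≡⟨ solve 2 (λ q r →
        (q :+ r) :* (q :+ r) :- q :* q := r :* ((q :+ q) :+ r)) refl (q m) (recip m) ⟩
      recip m * (q m + q m + recip m)                        ≤⟨ ℚ.*-monoˡ-≤-nonNeg (recip m) {{nonNegative (recip-nonNeg m)}}
        (ℚ.+-mono-≤ (ℚ.+-mono-≤ (√-seq-≤ n m 0) (√-seq-≤ n m 0)) (recip≤1 m)) ⟩
      recip m * C                                            ∎)
    where
    0≤1 : 0ℚ ≤ 1ℚ
    0≤1 = ℚ.<⇒≤ (ℚ.positive⁻¹ 1ℚ)
    0≤q₀+1 : 0ℚ ≤ q 0 + 1ℚ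
    0≤q₀+1 = 0≤+ (q-nonNeg 0) 0≤1

-- Orthonormal bases

module _ {c ℓ} (R : CommutativeRing c ℓ) where

  open CommutativeRing R hiding (zero; sym; trans; refl)
  open import Algebra.Properties.Semiring.Sum semiring
  open import Relation.Binary.Reasoning.Setoid setoid

  δ : ∀ {n} → Fin n → Fin n → Carrier
  δ j k = if does (j F.≟ k) then 1# else 0#

  sum-0* : ∀ {n} (x : Fin n → Carrier) → sum (λ l → 0# * x l) ≈ 0#
  sum-0* x = begin
    sum (λ l → 0# * x l)   ≈⟨ *-distribˡ-sum 0# x ⟨
    0# * sum x             ≈⟨ zeroˡ (sum x) ⟩
    0#                     ∎

  sum-δ : ∀ {n} (x : Fin n → Carrier) j → sum (λ l → δ j l * x l) ≈ x j
  sum-δ x zero    = begin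
    1# * x zero + sum (λ l → 0# * x (suc l))   ≈⟨ +-cong (*-identityˡ (x zero)) (sum-0* (x ∘ suc)) ⟩
    x zero + 0#                                ≈⟨ +-identityʳ (x zero) ⟩
    x zero                                     ∎
  sum-δ x (suc j) = begin
    0# * x zero + sum (λ l → δ j l * x (suc l))   ≈⟨ +-cong (zeroˡ (x zero)) (sum-δ (x ∘ suc) j) ⟩
    0# + x (suc j)                                ≈⟨ +-identityˡ (x (suc j)) ⟩
    x (suc j)                                     ∎

  -- P(Qx) = (PQ)x = x. It serves twice: with PQ = B* B for independence and with PQ = B B* for
  -- spanning.
  left-inverse : ∀ {m n} (P : Fin m → Fin n → Carrier) (Q : Fin n → Fin m → Carrier) →
                 (∀ j l → sum (λ k → P j k * Q k l) ≈ δ j l) →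
                 ∀ x j → sum (λ k → P j k * sum (λ l → Q k l * x l)) ≈ x j
  left-inverse P Q PQ≈δ x j = begin
    sum (λ k → P j k * sum (λ l → Q k l * x l))
      ≈⟨ sum-cong-≋ (λ k → *-distribˡ-sum (P j k) (λ l → Q k l * x l)) ⟩
    sum (λ k → sum (λ l → P j k * (Q k l * x l)))
      ≈⟨ ∑-comm (λ k l → P j k * (Q k l * x l)) ⟩
    sum (λ l → sum (λ k → P j k * (Q k l * x l)))
      ≈⟨ sum-cong-≋ (λ l → begin
           sum (λ k → P j k * (Q k l * x l))   ≈⟨ sum-cong-≋ (λ k → *-assoc (P j k) (Q k l) (x l)) ⟨
           sum (λ k → P j k * Q k l * x l)     ≈⟨ *-distribʳ-sum (x l) (λ k → P j k * Q k l) ⟨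
           sum (λ k → P j k * Q k l) * x l     ≈⟨ *-congʳ (PQ≈δ j l) ⟩
           δ j l * x l                         ∎) ⟩
    sum (λ l → δ j l * x l)
      ≈⟨ sum-δ x j ⟩
    x j ∎



open import Algebra.Properties.Semiring.Sum C.semiring using (sum-cong-≋; *-distribˡ-sum)

δᶜ : ∀ {n} → Fin n → Fin n → ℂ
δᶜ = δ ℂ-commutativeRing

δᶜ-diagonal : ∀ {n} (j : Fin n) → δᶜ j j ≡ 1ℂ
δᶜ-diagonal j = cong (if_then 1ℂ else 0ℂ) (dec-true (j F.≟ j) refl)

δᶜ-off-diagonal : ∀ {n} {j k : Fin n} → j ≢ k → δᶜ j k ≡ 0ℂ
δᶜ-off-diagonal {_} {j} {k} j≢k = cong (if_then 1ℂ else 0ℂ) (dec-false (j F.≟ k) j≢k)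

-- Let T send v to its coefficients ⟨b j, v⟩ and let L form linear combinations. The first
-- hypothesis says T L = 1, which makes L injective; the second says L T = 1, which makes L
-- surjective with explicit coefficients.
isOrthonormalBasis : ∀ {m n} (b : Fin m → Vector ℂ n) →
  (∀ j k → ⟨ b j , b k ⟩ ≃ δᶜ j k) →
  (∀ r s → ℂ.sum (λ j → b j r *ᶜ ℂ.conj (b j s)) ≃ δᶜ r s) →
  IsOrthonormalBasis b
isOrthonormalBasis b gram completeness = record
  { unit                = λ j → unwrap (C.trans (gram j j) (C.reflexive (δᶜ-diagonal j)))
  ; orthogonal          = λ j k j≢k → unwrap (C.trans (gram j k) (C.reflexive (δᶜ-off-diagonal j≢k)))
  ; linearlyIndependent = λ c cb≈0 j → unwrap (begin
      c j
        ≈⟨ left-inverse ℂ-commutativeRing b* bᵀ gram c j ⟨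
      ℂ.sum (λ r → b* j r *ᶜ ℂ.sum (λ k → b k r *ᶜ c k))
        ≈⟨ sum-cong-≋ (λ r → C.*-congˡ {b* j r} (C.trans
             (sum-cong-≋ (λ k → C.*-comm (b k r) (c k))) (wrap (cb≈0 r)))) ⟩
      ℂ.sum (λ r → b* j r *ᶜ 0ℂ)
        ≈⟨ sum-cong-≋ (λ r → C.*-comm (b* j r) 0ℂ) ⟩
      ℂ.sum (λ r → 0ℂ *ᶜ b* j r)
        ≈⟨ sum-0* ℂ-commutativeRing (b* j) ⟩
      0ℂ ∎)
  ; spanning            = λ v → (λ j → ⟨ b j , v ⟩) , λ r → unwrap (begin
      ℂ.sum (λ j → ⟨ b j , v ⟩ *ᶜ b j r)
        ≈⟨ sum-cong-≋ (λ j → C.*-comm ⟨ b j , v ⟩ (b j r)) ⟩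
      ℂ.sum (λ j → b j r *ᶜ ℂ.sum (λ s → b* j s *ᶜ v s))
        ≈⟨ left-inverse ℂ-commutativeRing bᵀ b* completeness v r ⟩
      v r ∎)
  }
  where
  open import Relation.Binary.Reasoning.Setoid C.setoid
  b* = λ j r → ℂ.conj (b j r)
  bᵀ = λ r j → b j r

-- Eighth roots of unity

κ : ℚ → ℂ
κ q = ℂ.real (fromℚ q)

-- Coordinates on ℚ[x] / (x⁴ + 1) with respect to 1, x, x², x³.
Coordinates : Set
Coordinates = Vec ℚ 4

x^_ : ℕ → Coordinates
x^ zero  = 1ℚ ∷ 0ℚ ∷ 0ℚ ∷ 0ℚ ∷ []
x^ suc n = times-x (x^ n)
  where
  times-x : Coordinates → Coordinates
  times-x (a ∷ b ∷ c ∷ d ∷ []) = ℚ.- d ∷ a ∷ b ∷ c ∷ []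

powerSum : ∀ {n} → (Fin n → ℕ) → Coordinates
powerSum {zero}  e = Vec.replicate 4 0ℚ
powerSum {suc n} e = Vec.zipWith ℚ._+_ (x^ e zero) (powerSum (e ∘ suc))

-- The factor 1/6 = (1/√6)² of the inner products stays outside, so that the decided equations
-- concern sums of roots of unity alone.
6δ : Fin 6 → Fin 6 → Coordinates
6δ j k = if does (j F.≟ k) then + 6 ℚ./ 1 ∷ 0ℚ ∷ 0ℚ ∷ 0ℚ ∷ [] else Vec.replicate 4 0ℚ

-- Exponents of the entries of a matrix of eighth roots of unity; conjugation multiplies them by 7.
UnitaryExponents : (Fin 6 → Fin 6 → Fin 8) → Set
UnitaryExponents e =
  (∀ j k → powerSum (λ r → 7 ℕ.* toℕ (e j r) ℕ.+ toℕ (e k r)) ≡ 6δ j k) ×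
  (∀ r s → powerSum (λ j → 7 ℕ.* toℕ (e j s) ℕ.+ toℕ (e j r)) ≡ 6δ r s)

unitaryExponents? : ∀ e → Dec (UnitaryExponents e)
unitaryExponents? e =
  F.all? (λ j → F.all? (λ k → Vec.≡-dec ℚ._≟_ (powerSum (λ r → 7 ℕ.* toℕ (e j r) ℕ.+ toℕ (e k r))) (6δ j k)))
  ×-dec
  F.all? (λ r → F.all? (λ s → Vec.≡-dec ℚ._≟_ (powerSum (λ j → 7 ℕ.* toℕ (e j s) ℕ.+ toℕ (e j r))) (6δ r s)))

-- Exponent vectors of the entries of Φ₁₉

exponent : Fin 6 → Fin 6 → Fin 6 → Fin 8
exponent i j r = (toℕ (Vec.lookup (Vec.lookup A r) i) ℕ.+ toℕ (Vec.lookup (Vec.lookup A r) j)) mod 8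

unitaryExponents : ∀ i → UnitaryExponents (exponent i) × UnitaryExponents (λ j → exponent j i)
unitaryExponents = from-yes (F.all? (λ i → unitaryExponents? (exponent i) ×-dec unitaryExponents? (λ j → exponent j i)))

-- The array is symmetric, which leaves 21 pairs i ≤ j. The two missing ones are (2, 5) and (3, 4):
-- columns 2 and 5 of `A`, and likewise columns 3 and 4, add up to column 1 modulo 8, so both
-- entries coincide with entry (0, 1).
representatives : Vec (Fin 6 × Fin 6) 19
representatives =
  (# 0 , # 0) ∷ (# 0 , # 1) ∷ (# 0 , # 2) ∷ (# 0 , # 3) ∷ (# 0 , # 4) ∷ (# 0 , # 5) ∷
  (# 1 , # 1) ∷ (# 1 , # 2) ∷ (# 1 , # 3) ∷ (# 1 , # 4) ∷ (# 1 , # 5) ∷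
  (# 2 , # 2) ∷ (# 2 , # 3) ∷ (# 2 , # 4) ∷
  (# 3 , # 3) ∷ (# 3 , # 5) ∷
  (# 4 , # 4) ∷ (# 4 , # 5) ∷
  (# 5 , # 5) ∷ []

representative-exponent : Fin 19 → Fin 6 → Fin 8
representative-exponent c = exponent (proj₁ (Vec.lookup representatives c)) (proj₂ (Vec.lookup representatives c))

representatives-distinct : ∀ c d → (∀ r → representative-exponent c r ≡ representative-exponent d r) → c ≡ d
representatives-distinct = from-yes (F.all? (λ c → F.all? (λ d →
  F.all? (λ r → representative-exponent c r F.≟ representative-exponent d r) →-dec (c F.≟ d))))

representatives-complete : ∀ i j → ∃ λ c → ∀ r → representative-exponent c r ≡ exponent i j r
representatives-complete = from-yes (F.all? (λ i → F.all? (λ j →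
  F.any? (λ c → F.all? (λ r → representative-exponent c r F.≟ exponent i j r)))))

-- Evaluation at a primitive eighth root of unity

module EighthRoot (z : ℂ) (z⁴≃-1 : z ^ 4 ≃ -ᶜ 1ℂ) (conj-z*z≃1 : ℂ.conj z *ᶜ z ≃ 1ℂ) where

  open import Relation.Binary.Reasoning.Setoid C.setoid
  open ℚ[i]-Solver

  z⁸≃1 : z ^ 8 ≃ 1ℂ
  z⁸≃1 = begin
    z ^ 8                ≈⟨ ^-homo-* z 4 4 ⟩
    z ^ 4 *ᶜ z ^ 4       ≈⟨ C.*-cong z⁴≃-1 z⁴≃-1 ⟩
    (-ᶜ 1ℂ) *ᶜ (-ᶜ 1ℂ)   ≈⟨ ≃-pointwise (λ _ → refl) ⟩
    1ℂ                   ∎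

  z^8* : ∀ m → z ^ (8 ℕ.* m) ≃ 1ℂ
  z^8* m = C.trans (C.sym (^-assocʳ z 8 m)) (C.trans (^-congˡ m z⁸≃1) (1^ m))
    where
    1^ : ∀ m → 1ℂ ^ m ≃ 1ℂ
    1^ zero    = C.refl
    1^ (suc m) = C.trans (C.*-identityˡ (1ℂ ^ m)) (1^ m)

  z^-mod : ∀ n → z ^ n ≃ z ^ (n ℕ.% 8)
  z^-mod n = begin
    z ^ n                                    ≈⟨ C.reflexive (cong (z ^_)
      (trans (ℕ.m≡m%n+[m/n]*n n 8) (cong (n ℕ.% 8 ℕ.+_) (ℕ.*-comm (n ℕ./ 8) 8)))) ⟩
    z ^ (n ℕ.% 8 ℕ.+ 8 ℕ.* (n ℕ./ 8))        ≈⟨ ^-homo-* z (n ℕ.% 8) (8 ℕ.* (n ℕ./ 8)) ⟩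
    z ^ (n ℕ.% 8) *ᶜ z ^ (8 ℕ.* (n ℕ./ 8))   ≈⟨ C.*-congˡ (z^8* (n ℕ./ 8)) ⟩
    z ^ (n ℕ.% 8) *ᶜ 1ℂ                      ≈⟨ C.*-identityʳ _ ⟩
    z ^ (n ℕ.% 8)                            ∎

  conj-z^ : ∀ n → ℂ.conj (z ^ n) ≃ z ^ (7 ℕ.* n)
  conj-z^ n = begin
    ℂ.conj (z ^ n)   ≈⟨ conj-^ᶜ n ⟩
    ℂ.conj z ^ n     ≈⟨ ^-congˡ n conj-z ⟩
    (z ^ 7) ^ n      ≈⟨ ^-assocʳ z 7 n ⟩
    z ^ (7 ℕ.* n)    ∎
    where
    conj-^ᶜ : ∀ n → ℂ.conj (z ^ n) ≃ ℂ.conj z ^ n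
    conj-^ᶜ zero    = ≃-pointwise (λ _ → refl)
    conj-^ᶜ (suc n) = C.trans (conj-* z (z ^ n)) (C.*-congˡ (conj-^ᶜ n))
    conj-z : ℂ.conj z ≃ z ^ 7
    conj-z = begin
      ℂ.conj z                   ≈⟨ C.*-identityʳ (ℂ.conj z) ⟨
      ℂ.conj z *ᶜ 1ℂ             ≈⟨ C.*-congˡ z⁸≃1 ⟨
      ℂ.conj z *ᶜ (z *ᶜ z ^ 7)   ≈⟨ C.*-assoc (ℂ.conj z) z (z ^ 7) ⟨
      (ℂ.conj z *ᶜ z) *ᶜ z ^ 7   ≈⟨ C.*-congʳ conj-z*z≃1 ⟩
      1ℂ *ᶜ z ^ 7                ≈⟨ C.*-identityˡ (z ^ 7) ⟩
      z ^ 7                      ∎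

  -- Horner's rule; on length 4 it realises the map from ℚ[x] / (x⁴ + 1) to ℂ that sends x to z.
  eval : ∀ {n} → Vec ℚ n → ℂ
  eval []      = 0ℂ
  eval (q ∷ p) = κ q +ᶜ z *ᶜ eval p

  eval-+ : ∀ {n} (p q : Vec ℚ n) → eval (Vec.zipWith ℚ._+_ p q) ≃ eval p +ᶜ eval q
  eval-+ []      []      = ≃-pointwise (λ _ → refl)
  eval-+ (a ∷ p) (b ∷ q) = begin
    κ (a ℚ.+ b) +ᶜ z *ᶜ eval (Vec.zipWith ℚ._+_ p q)   ≈⟨ C.+-congˡ (C.*-congˡ (eval-+ p q)) ⟩
    κ (a ℚ.+ b) +ᶜ z *ᶜ (eval p +ᶜ eval q)             ≈⟨ ≃-pointwise (λ n →
      solve 5 (λ a b z p q → (a :+ b) :+ z :* (p :+ q) := (a :+ z :* p) :+ (b :+ z :* q)) refl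
        (approx (κ a) n) (approx (κ b) n) (approx z n) (approx (eval p) n) (approx (eval q) n)) ⟩
    (κ a +ᶜ z *ᶜ eval p) +ᶜ (κ b +ᶜ z *ᶜ eval q)       ∎

  eval-0 : ∀ n → eval (Vec.replicate n 0ℚ) ≃ 0ℂ
  eval-0 zero    = C.refl
  eval-0 (suc n) = C.trans (C.+-congˡ (C.*-congˡ (eval-0 n))) (C.trans (C.+-identityˡ _) (C.zeroʳ z))

  eval-x^ : ∀ n → eval (x^ n) ≃ z ^ n
  eval-x^ zero    = ≃-pointwise (λ n → solve 1 (λ z →
    con 1ℚ[i] :+ z :* (con 0ℚ[i] :+ z :* (con 0ℚ[i] :+ z :* (con 0ℚ[i] :+ z :* con 0ℚ[i]))) := con 1ℚ[i]) refl (approx z n))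
  eval-x^ (suc n) with x^ n | eval-x^ n
  ... | a ∷ b ∷ c ∷ d ∷ [] | eq = begin
    eval (ℚ.- d ∷ a ∷ b ∷ c ∷ [])
      -- Wrapping d round to -d changes the value by -d (z⁴ + 1), which is displayed so that z⁴ = -1
      -- can remove it.
      ≈⟨ ≃-pointwise (λ n → solve 5 (λ z a b c d →
           :- d :+ z :* (a :+ z :* (b :+ z :* (c :+ z :* con 0ℚ[i]))) :=
           z :* (a :+ z :* (b :+ z :* (c :+ z :* (d :+ z :* con 0ℚ[i])))) :+
           (z :* (z :* (z :* (z :* con 1ℚ[i]))) :+ con 1ℚ[i]) :* :- d) refl
           (approx z n) (approx (κ a) n) (approx (κ b) n) (approx (κ c) n) (approx (κ d) n)) ⟩
    z *ᶜ eval (a ∷ b ∷ c ∷ d ∷ []) +ᶜ (z ^ 4 +ᶜ 1ℂ) *ᶜ (-ᶜ κ d)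
      ≈⟨ C.+-cong (C.*-congˡ eq) (C.*-congʳ (C.+-congʳ z⁴≃-1)) ⟩
    z *ᶜ z ^ n +ᶜ ((-ᶜ 1ℂ) +ᶜ 1ℂ) *ᶜ (-ᶜ κ d)
      ≈⟨ ≃-pointwise (λ m → solve 2 (λ p d →
           p :+ (:- con 1ℚ[i] :+ con 1ℚ[i]) :* :- d := p) refl (approx (z *ᶜ z ^ n) m) (approx (κ d) m)) ⟩
    z *ᶜ z ^ n ∎

  eval-powerSum : ∀ {n} (e : Fin n → ℕ) → eval (powerSum e) ≃ ℂ.sum (λ r → z ^ e r)
  eval-powerSum {zero}  e = eval-0 4
  eval-powerSum {suc n} e = C.trans (eval-+ (x^ e zero) (powerSum (e ∘ suc)))
    (C.+-cong (eval-x^ (e zero)) (eval-powerSum (e ∘ suc)))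

  eval-6δ : ∀ j k → κ (+ 1 ℚ./ 6) *ᶜ eval (6δ j k) ≃ δᶜ j k
  eval-6δ j k with does (j F.≟ k)
  ... | true  = C.trans (C.*-congˡ constant) (≃-pointwise (λ _ → refl))
    where
    constant : eval (+ 6 ℚ./ 1 ∷ 0ℚ ∷ 0ℚ ∷ 0ℚ ∷ []) ≃ κ (+ 6 ℚ./ 1)
    constant = C.trans (C.+-congˡ (C.trans (C.*-congˡ (eval-0 3)) (C.zeroʳ z))) (C.+-identityʳ (κ (+ 6 ℚ./ 1)))
  ... | false = C.trans (C.*-congˡ (eval-0 4)) (C.zeroʳ _)

  -- The real parts stay at distance 2, which ε = 1 refutes. The distinctness of all eight powers of
  -- z reduces to this.
  1≄-1 : ¬ 1ℂ ≃ -ᶜ 1ℂ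
  1≄-1 (wrap (p , _)) = from-bound (p 1ℚ (ℚ.positive⁻¹ 1ℚ))
    where
    from-bound : (∃ λ N → ∀ n → N ℕ.≤ n → (1ℚ ℚ.+ 1ℚ) ℚ.< 1ℚ) → ⊥
    from-bound (N , h) = from-no ((1ℚ ℚ.+ 1ℚ) ℚ.<? 1ℚ) (h N ℕ.≤-refl)

  -- Some multiple of a − b is 4 modulo 8.
  z^-injective : ∀ (a b : Fin 8) → z ^ toℕ a ≃ z ^ toℕ b → a ≡ b
  z^-injective a b eq = case (separated a b)
    where
    -- m = 4, 2, 1 works according as a - b is exactly divisible by 1, 2 or 4, whence `Fin 5`; the
    -- factor 7 stands for -1 modulo 8.
    separated : ∀ (a b : Fin 8) → a ≡ b ⊎ ∃ λ (m : Fin 5) → (toℕ a ℕ.* toℕ m ℕ.+ 7 ℕ.* (toℕ b ℕ.* toℕ m)) ℕ.% 8 ≡ 4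
    separated = from-yes (F.all? (λ (a : Fin 8) → F.all? (λ (b : Fin 8) → (a F.≟ b) ⊎-dec
      F.any? (λ (m : Fin 5) → (toℕ a ℕ.* toℕ m ℕ.+ 7 ℕ.* (toℕ b ℕ.* toℕ m)) ℕ.% 8 ℕ.≟ 4))))
    case : (a ≡ b ⊎ ∃ λ (m : Fin 5) → (toℕ a ℕ.* toℕ m ℕ.+ 7 ℕ.* (toℕ b ℕ.* toℕ m)) ℕ.% 8 ≡ 4) → a ≡ b
    case (inj₁ a≡b)        = a≡b
    case (inj₂ (m′ , h)) = ⊥-elim (1≄-1 (begin
      1ℂ                              ≈⟨ z^8* bm ⟨
      z ^ (8 ℕ.* bm)                  ≈⟨ ^-homo-* z bm (7 ℕ.* bm) ⟩
      z ^ bm *ᶜ z ^ (7 ℕ.* bm)        ≈⟨ C.*-congʳ (C.trans (C.sym (^-assocʳ z (toℕ b) m))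
                                                (C.trans (^-congˡ m (C.sym eq)) (^-assocʳ z (toℕ a) m))) ⟩
      z ^ am *ᶜ z ^ (7 ℕ.* bm)        ≈⟨ ^-homo-* z am (7 ℕ.* bm) ⟨
      z ^ (am ℕ.+ 7 ℕ.* bm)           ≈⟨ z^-mod (am ℕ.+ 7 ℕ.* bm) ⟩
      z ^ ((am ℕ.+ 7 ℕ.* bm) ℕ.% 8)   ≈⟨ C.reflexive (cong (z ^_) h) ⟩
      z ^ 4                           ≈⟨ z⁴≃-1 ⟩
      -ᶜ 1ℂ                           ∎))
      where
      m  = toℕ m′
      am = toℕ a ℕ.* m
      bm = toℕ b ℕ.* m

  module _ (ρ : ℂ) (conj-ρ≃ρ : ℂ.conj ρ ≃ ρ) (ρ²≃⅙ : ρ *ᶜ ρ ≃ κ (+ 1 ℚ./ 6)) where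

    exponents⇒orthonormalBasis : (b : Fin 6 → Vector ℂ 6) (e : Fin 6 → Fin 6 → Fin 8) →
      (∀ j r → b j r ≃ ρ *ᶜ z ^ toℕ (e j r)) → UnitaryExponents e → IsOrthonormalBasis b
    exponents⇒orthonormalBasis b e entry (gram , completeness) = isOrthonormalBasis b
      (λ j k → entries-δ j k (λ r → 7 ℕ.* toℕ (e j r) ℕ.+ toℕ (e k r))
        (λ r → conj-product (toℕ (e j r)) (toℕ (e k r)) (entry j r) (entry k r)) (gram j k))
      (λ r s → entries-δ r s (λ j → 7 ℕ.* toℕ (e j s) ℕ.+ toℕ (e j r))
        (λ j → C.trans (C.*-comm (b j r) (ℂ.conj (b j s)))
          (conj-product (toℕ (e j s)) (toℕ (e j r)) (entry j s) (entry j r))) (completeness r s))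
      where
      conj-product : ∀ {u v} m n → u ≃ ρ *ᶜ z ^ m → v ≃ ρ *ᶜ z ^ n →
        ℂ.conj u *ᶜ v ≃ κ (+ 1 ℚ./ 6) *ᶜ z ^ (7 ℕ.* m ℕ.+ n)
      conj-product {u} {v} m n p q = begin
        ℂ.conj u *ᶜ v                          ≈⟨ C.*-cong (C.trans (conj-cong p) (C.trans (conj-* ρ (z ^ m))
                                                                  (C.*-cong conj-ρ≃ρ (conj-z^ m)))) q ⟩
        (ρ *ᶜ z ^ (7 ℕ.* m)) *ᶜ (ρ *ᶜ z ^ n)   ≈⟨ ≃-pointwise (λ i → solve 3 (λ r x y →
          (r :* x) :* (r :* y) := (r :* r) :* (x :* y)) refl (approx ρ i) (approx (z ^ (7 ℕ.* m)) i) (approx (z ^ n) i)) ⟩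
        (ρ *ᶜ ρ) *ᶜ (z ^ (7 ℕ.* m) *ᶜ z ^ n)   ≈⟨ C.*-cong ρ²≃⅙ (C.sym (^-homo-* z (7 ℕ.* m) n)) ⟩
        κ (+ 1 ℚ./ 6) *ᶜ z ^ (7 ℕ.* m ℕ.+ n)   ∎
      entries-δ : ∀ j k (f : Fin 6 → ℕ) {x : Fin 6 → ℂ} → (∀ r → x r ≃ κ (+ 1 ℚ./ 6) *ᶜ z ^ f r) →
        powerSum f ≡ 6δ j k → ℂ.sum x ≃ δᶜ j k
      entries-δ j k f {x} p q = begin
        ℂ.sum x                                  ≈⟨ sum-cong-≋ p ⟩
        ℂ.sum (λ r → κ (+ 1 ℚ./ 6) *ᶜ z ^ f r)   ≈⟨ *-distribˡ-sum (κ (+ 1 ℚ./ 6)) (λ r → z ^ f r) ⟨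
        κ (+ 1 ℚ./ 6) *ᶜ ℂ.sum (λ r → z ^ f r)   ≈⟨ C.*-congˡ (eval-powerSum f) ⟨
        κ (+ 1 ℚ./ 6) *ᶜ eval (powerSum f)       ≈⟨ C.reflexive (cong (λ p → κ (+ 1 ℚ./ 6) *ᶜ eval p) q) ⟩
        κ (+ 1 ℚ./ 6) *ᶜ eval (6δ j k)           ≈⟨ eval-6δ j k ⟩
        δᶜ j k                                   ∎

    -- ρ has the inverse 6ρ, because ρ² = 1/6.
    ρ-cancel : ∀ {u v} → ρ *ᶜ u ≃ ρ *ᶜ v → u ≃ v
    ρ-cancel {u} {v} eq = C.trans (C.sym (expand u)) (C.trans (C.*-congˡ (C.*-congˡ eq)) (expand v))
      where
      expand : ∀ u → κ (+ 6 ℚ./ 1) *ᶜ (ρ *ᶜ (ρ *ᶜ u)) ≃ u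
      expand u = begin
        κ (+ 6 ℚ./ 1) *ᶜ (ρ *ᶜ (ρ *ᶜ u))        ≈⟨ C.*-congˡ (C.*-assoc ρ ρ u) ⟨
        κ (+ 6 ℚ./ 1) *ᶜ ((ρ *ᶜ ρ) *ᶜ u)        ≈⟨ C.*-assoc (κ (+ 6 ℚ./ 1)) (ρ *ᶜ ρ) u ⟨
        (κ (+ 6 ℚ./ 1) *ᶜ (ρ *ᶜ ρ)) *ᶜ u        ≈⟨ C.*-congʳ (C.*-congˡ ρ²≃⅙) ⟩
        (κ (+ 6 ℚ./ 1) *ᶜ κ (+ 1 ℚ./ 6)) *ᶜ u   ≈⟨ C.*-congʳ (≃-pointwise (λ _ → refl)) ⟩
        1ℂ *ᶜ u                                 ≈⟨ C.*-identityˡ u ⟩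
        u                                       ∎

    module _ (Φ : Array 6) (entry : ∀ i j r → Φ i j r ≃ ρ *ᶜ z ^ toℕ (exponent i j r)) where

      isQuantumLatinSquare : IsQuantumLatinSquare Φ
      isQuantumLatinSquare = record
        { unit    = λ i j → IsOrthonormalBasis.unit (row i) j
        ; rows    = row
        ; columns = λ j → exponents⇒orthonormalBasis (λ i → Φ i j) (λ i → exponent i j) (λ i → entry i j)
            (proj₂ (unitaryExponents j))
        }
        where
        row : ∀ i → IsOrthonormalBasis (Φ i)
        row i = exponents⇒orthonormalBasis (Φ i) (exponent i) (entry i) (proj₁ (unitaryExponents i))

      exponents⇒∼ : ∀ i j k l → (∀ r → exponent i j r ≡ exponent k l r) → Φ i j ∼ Φ k l
      exponents⇒∼ i j k l same = 0ℝ , λ r → unwrap (begin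
        Φ i j r                         ≈⟨ entry i j r ⟩
        ρ *ᶜ z ^ toℕ (exponent i j r)   ≈⟨ C.reflexive (cong (λ e → ρ *ᶜ z ^ toℕ e) (same r)) ⟩
        ρ *ᶜ z ^ toℕ (exponent k l r)   ≈⟨ entry k l r ⟨
        Φ k l r                         ≈⟨ C.*-identityˡ (Φ k l r) ⟨
        1ℂ *ᶜ Φ k l r                   ≈⟨ C.*-congʳ cis-0 ⟨
        cis 0ℝ *ᶜ Φ k l r               ∎)

      -- All entries have first coordinate 1/√6, so the phase is 1.
      ∼⇒exponents : ∀ i j k l → Φ i j ∼ Φ k l → ∀ r → exponent i j r ≡ exponent k l r
      ∼⇒exponents i j k l (α , eq) r = z^-injective (exponent i j r) (exponent k l r) (ρ-cancel (begin
        ρ *ᶜ z ^ toℕ (exponent i j r)   ≈⟨ entry i j r ⟨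
        Φ i j r                         ≈⟨ wrap (eq r) ⟩
        cis α *ᶜ Φ k l r                ≈⟨ C.*-congʳ phase≃1 ⟩
        1ℂ *ᶜ Φ k l r                   ≈⟨ C.*-identityˡ (Φ k l r) ⟩
        Φ k l r                         ≈⟨ entry k l r ⟩
        ρ *ᶜ z ^ toℕ (exponent k l r)   ∎))
        where
        first : ∀ i j → Φ i j zero ≃ ρ *ᶜ 1ℂ
        first i j = C.trans (entry i j zero) (C.reflexive (cong (λ e → ρ *ᶜ z ^ toℕ e) (exponent-0 i j)))
          where
          exponent-0 : ∀ i j → exponent i j zero ≡ zero
          exponent-0 = from-yes (F.all? (λ i → F.all? (λ j → exponent i j zero F.≟ zero)))
        phase≃1 : cis α ≃ 1ℂ
        phase≃1 = C.sym (ρ-cancel (begin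
          ρ *ᶜ 1ℂ               ≈⟨ first i j ⟨
          Φ i j zero            ≈⟨ wrap (eq zero) ⟩
          cis α *ᶜ Φ k l zero   ≈⟨ C.*-congˡ (first k l) ⟩
          cis α *ᶜ (ρ *ᶜ 1ℂ)    ≈⟨ C.*-congˡ (C.*-identityʳ ρ) ⟩
          cis α *ᶜ ρ            ≈⟨ C.*-comm (cis α) ρ ⟩
          ρ *ᶜ cis α            ∎))

      hasCardinality-19 : HasCardinality Φ 19
      hasCardinality-19 =
        Vec.lookup representatives ,
        (λ {c} {d} same → representatives-distinct c d (∼⇒exponents _ _ _ _ same)) ,
        λ (i , j) → proj₁ (representatives-complete i j) ,
          λ { refl → exponents⇒∼ _ _ i j (proj₂ (representatives-complete i j)) }

-- Specialisation to ζ and 1/√6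

-- The two powers are taken in raw rings with different equalities.
ℂ-^≡^ : ∀ z n → z ℂ.^ n ≡ z ^ n
ℂ-^≡^ z zero    = refl
ℂ-^≡^ z (suc n) = cong (z *ᶜ_) (ℂ-^≡^ z n)

1/√6-square : ℂ.real (1/√ 6) *ᶜ ℂ.real (1/√ 6) ≃ κ (+ 1 ℚ./ 6)
1/√6-square = begin
  ℂ.real (1/√ 6) *ᶜ ℂ.real (1/√ 6)   ≈⟨ ≃-pointwise (λ n → square (+ 1 ℚ./ 6) (seq (√ 6) n)) ⟩
  κ c² *ᶜ ℂ.real (√ 6 *ʳ √ 6)        ≈⟨ C.*-congˡ (wrap (√-square 6 , ≈ʳ-pointwise {0ℝ} {0ℝ} (λ _ → refl))) ⟩
  κ c² *ᶜ κ (ι 6)                    ≈⟨ ≃-pointwise (λ _ → refl) ⟩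
  κ (+ 1 ℚ./ 6)                      ∎
  where
  open import Relation.Binary.Reasoning.Setoid C.setoid
  open ℚSolver.+-*-Solver
  c² = (+ 1 ℚ./ 6) ℚ.* (+ 1 ℚ./ 6)
  square : ∀ c x → ℚ[i].real (c ℚ.* x) ⊗ ℚ[i].real (c ℚ.* x) ≡ ℚ[i].real (c ℚ.* c) ⊗ ℚ[i].real (x ℚ.* x)
  square c x = cong₂ _+i_
    (solve 2 (λ c x → (c :* x) :* (c :* x) :+ :- (con 0ℚ :* con 0ℚ) :=
                      (c :* c) :* (x :* x) :+ :- (con 0ℚ :* con 0ℚ)) refl c x)
    (solve 2 (λ c x → (c :* x) :* con 0ℚ :+ con 0ℚ :* (c :* x) :=
                      (c :* c) :* con 0ℚ :+ con 0ℚ :* (x :* x)) refl c x)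

theorem1 : (π : ℝ) → IsPi π →
    IsQuantumLatinSquare (Φ₁₉ π) × HasCardinality (Φ₁₉ π) 19
theorem1 π isPi =
  isQuantumLatinSquare ρ conj-ρ 1/√6-square (Φ₁₉ π) entry ,
  hasCardinality-19 ρ conj-ρ 1/√6-square (Φ₁₉ π) entry
  where
  open import Relation.Binary.Reasoning.Setoid C.setoid
  open EighthRoot (ζ π) (ζ⁴≃-1 isPi) (conj-cis-* (fromℚ (+ 1 ℚ./ 4) *ʳ π))
  z = ζ π
  ρ = ℂ.real (1/√ 6)
  conj-ρ : ℂ.conj ρ ≃ ρ
  conj-ρ = ≃-pointwise (λ _ → refl)
  entry : ∀ i j r → Φ₁₉ π i j r ≃ ρ *ᶜ z ^ toℕ (exponent i j r)
  entry i j r = C.*-congˡ (begin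
    z ℂ.^ a *ᶜ z ℂ.^ b         ≈⟨ C.*-cong (C.reflexive (ℂ-^≡^ z a)) (C.reflexive (ℂ-^≡^ z b)) ⟩
    z ^ a *ᶜ z ^ b             ≈⟨ ^-homo-* z a b ⟨
    z ^ (a ℕ.+ b)              ≈⟨ z^-mod (a ℕ.+ b) ⟩
    z ^ ((a ℕ.+ b) ℕ.% 8)      ≈⟨ C.reflexive (cong (z ^_) (sym (F.toℕ-fromℕ< (ℕ.m%n<n (a ℕ.+ b) 8)))) ⟩
    z ^ toℕ (exponent i j r)   ∎)
    where
    a = toℕ (Vec.lookup (Vec.lookup A r) i)
    b = toℕ (Vec.lookup (Vec.lookup A r) j)
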